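{- We have $$C_{1324,2431}(x)=P(x)\cdot\sum_{k\ge 0}\mathrm{steep}(k)\,x^k,$$ where $\mathrm{steep}(k)$ is the number of steep partitions of $k$ and $P(x)=\sum_{k\ge0}p(k)x^k$ is the generating function of the integer partition numbers $p(k)$.
   Context: An integer partition $\lambda$ is called steep if the difference between any two consecutive distinct part sizes of $\lambda$ (positive parts only) is greater than or equal to the multiplicity of the smaller of the two. (For example $(5,5,3,3,2,1)$ is steep, but $(3,2,2)$ and $(5,3,3,3,1)$ are not; the empty partition is steep.) $\mathrm{av}_n^k(B)$ is the number of permutations in $S_n$ with exactly $k$ inversions (pairs $i<j$ with $\pi_i>\pi_j$) that avoid every pattern in $B$; a permutation avoids a pattern $q$ if it has no subsequence order-isomorphic to $q$. If for every $k\ge0$ there are constants $m_k,c_k(B)$ with $\mathrm{av}_n^k(B)=c_k(B)$ for all $n\ge m_k$, then $(c_k(B))_{k\ge0}$ is the limit sequence of $B$ and $C_B(x)=\sum_{k\ge 0}c_k(B)x^k$ is its limit generating function; here $B=\{1324,2431\}$. -}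

module Defs where

open import Data.Fin as Fin using (Fin)
open import Data.Fin.Properties as Fin using ()
open import Data.List using (List; []; _∷_; length; filter; map; concatMap; upTo; allFin; cartesianProduct; cartesianProductWith)
import Data.List as List
open import Data.List.Membership.Propositional using (_∈_; lose; find)
open import Data.List.Membership.Propositional.Properties using (∈-cartesianProductWith⁺; ∈-allFin; ∈-upTo⁺; ∈-map⁺; ∈-concatMap⁺; ∈-filter⁺)
open import Data.List.Relation.Unary.All as All using (All; []; _∷_)
open import Data.List.Relation.Unary.Any as Any using (here)
open import Data.List.Relation.Unary.Linked using (Linked; linked?)
open import Data.Nat using (ℕ; zero; suc; _+_; _*_; _∸_; _⊔_; _≤_; _<_; _≥_; _≤?_; _<?_; _≥?_; _≟_; z≤n; s≤s)
open import Data.Nat.ListAction using (sum)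
open import Data.Nat.Properties using (≤-trans; ≤-refl; m≤m+n; m≤n+m; +-mono-≤; m≤m⊔n; m≤n⊔m)
open import Data.Product using (_×_; _,_; ∃; proj₁; proj₂)
open import Data.Sum using (_⊎_)
open import Data.Vec as Vec using (Vec; []; _∷_; lookup)
open import Data.Vec.Properties using (toList∘fromList)
import Data.Vec.Relation.Unary.All as VecAll
import Data.Vec.Relation.Unary.AllPairs as VecAllPairs
open import Data.Vec.Relation.Unary.Unique.Propositional using (Unique)
open import Function using (_⇔_; mk⇔; Equivalence)
open import Relation.Binary.PropositionalEquality using (_≡_; _≗_; refl; sym; trans; subst)
open import Relation.Nullary using (Dec; ¬_; ¬?; _×-dec_; _⊎-dec_; _→-dec_)
open import Relation.Nullary.Decidable using (map′)
open import Relation.Unary using (Decidable)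

words : {A : Set} → List A → (m : ℕ) → List (Vec A m)
words as zero    = [] ∷ []
words as (suc m) = cartesianProductWith _∷_ as (words as m)

∈-words : {A : Set} {as : List A} {m : ℕ} {w : Vec A m} →
          VecAll.All (_∈ as) w → w ∈ words as m
∈-words VecAll.[]         = here refl
∈-words (p VecAll.∷ ps)   = ∈-cartesianProductWith⁺ _∷_ p (∈-words ps)

∈-finWords : ∀ {n m} (w : Vec (Fin n) m) → w ∈ words (allFin n) m
∈-finWords w = ∈-words (VecAll.universal ∈-allFin w)

_⇔-dec_ : {A B : Set} → Dec A → Dec B → Dec (A ⇔ B)
a? ⇔-dec b? = map′ (λ (f , g) → mk⇔ f g)
                   (λ e → Equivalence.to e , Equivalence.from e)
                   ((a? →-dec b?) ×-dec (b? →-dec a?))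

-- A permutation of size n is its one-line notation with values 0, …, n-1:
-- a word π : Vec (Fin n) n satisfying Unique π.

permutations : (n : ℕ) → List (Vec (Fin n) n)
permutations n = filter (VecAllPairs.allPairs? (λ i j → ¬? (i Fin.≟ j))) (words (allFin n) n)

∈-permutations : ∀ {n} {π : Vec (Fin n) n} → Unique π → π ∈ permutations n
∈-permutations {π = π} = ∈-filter⁺ _ (∈-finWords π)

IsInversion : ∀ {n} → Vec (Fin n) n → Fin n × Fin n → Set
IsInversion π (i , j) = i Fin.< j × lookup π j Fin.< lookup π i

isInversion? : ∀ {n} (π : Vec (Fin n) n) → Decidable (IsInversion π)
isInversion? π (i , j) = (i Fin.<? j) ×-dec (lookup π j Fin.<? lookup π i)

inversions : ∀ {n} → Vec (Fin n) n → ℕ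
inversions {n} π = length (filter (isInversion? π) (cartesianProduct (allFin n) (allFin n)))

-- Patterns are in one-line notation. Only the relative order of the entries
-- is used, so they may be written with values starting from 1.
Pattern : Set
Pattern = List ℕ

-- e lists the positions, from left to right, of a subsequence of π that is
-- order-isomorphic to q.
IsOccurrence : ∀ {n} (q : Pattern) → Vec (Fin n) n → Vec (Fin n) (length q) → Set
IsOccurrence q π e =
  (∀ a b → a Fin.< b → lookup e a Fin.< lookup e b) ×
  (∀ a b → (List.lookup q a < List.lookup q b) ⇔
           (lookup π (lookup e a) Fin.< lookup π (lookup e b)))

isOccurrence? : ∀ {n} (q : Pattern) (π : Vec (Fin n) n) → Decidable (IsOccurrence q π)
isOccurrence? q π e =
  (Fin.all? λ a → Fin.all? λ b → (a Fin.<? b) →-dec (lookup e a Fin.<? lookup e b)) ×-dec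
  (Fin.all? λ a → Fin.all? λ b →
    (List.lookup q a <? List.lookup q b) ⇔-dec
    (lookup π (lookup e a) Fin.<? lookup π (lookup e b)))

Contains : ∀ {n} → Vec (Fin n) n → Pattern → Set
Contains π q = ∃ λ e → IsOccurrence q π e

contains? : ∀ {n} (π : Vec (Fin n) n) → Decidable (Contains π)
contains? {n} π q = map′ (λ p → let (e , _ , occ) = find p in e , occ)
                         (λ (e , occ) → lose (∈-finWords e) occ)
                         (Any.any? (isOccurrence? q π) (words (allFin n) (length q)))

Avoids : ∀ {n} → List Pattern → Vec (Fin n) n → Set
Avoids B π = All (λ q → ¬ Contains π q) B

avoids? : ∀ {n} (B : List Pattern) → Decidable (Avoids {n} B)
avoids? B π = All.all? (λ q → ¬? (contains? π q)) B

av : (n k : ℕ) → List Pattern → ℕ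
av n k B = length (filter (λ π → (inversions π ≟ k) ×-dec avoids? B π) (permutations n))

-- A formal power series with coefficients in ℕ is its coefficient sequence.
Series : Set
Series = ℕ → ℕ

infixl 7 _·_
_·_ : Series → Series → Series
(f · g) k = sum (map (λ i → f i * g (k ∸ i)) (upTo (suc k)))

-- C is the limit sequence of B; as a Series it is the limit generating
-- function of B.
IsLimit : List Pattern → Series → Set
IsLimit B C = ∀ k → ∃ λ m → ∀ n → n ≥ m → av n k B ≡ C k

IsLimit-unique : ∀ {B C D} → IsLimit B C → IsLimit B D → C ≗ D
IsLimit-unique c d k with c k | d k
... | m , p | m′ , q = trans (sym (p (m ⊔ m′) (m≤m⊔n m m′))) (q (m ⊔ m′) (m≤n⊔m m m′))

IsPartition : ℕ → List ℕ → Set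
IsPartition k xs = Linked _≥_ xs × All (0 <_) xs × sum xs ≡ k

isPartition? : (k : ℕ) → Decidable (IsPartition k)
isPartition? k xs = linked? _≥?_ xs ×-dec All.all? (0 <?_) xs ×-dec (sum xs ≟ k)

-- A partition of k has at most k parts, each at most k.
partitions : ℕ → List (List ℕ)
partitions k = filter (isPartition? k)
  (concatMap (λ l → map Vec.toList (words (upTo (suc k)) l)) (upTo (suc k)))

∈-partitions : ∀ {k xs} → IsPartition k xs → xs ∈ partitions k
∈-partitions {k} {xs} isP@(_ , pos , refl) =
  ∈-filter⁺ (isPartition? k)
    (∈-concatMap⁺ (λ l → map Vec.toList (words (upTo (suc k)) l)) (lose (∈-upTo⁺ (s≤s (length≤sum pos)))
      (subst (_∈ map Vec.toList (words (upTo (suc k)) (length xs))) (toList∘fromList xs)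
        (∈-map⁺ Vec.toList (∈-words (bounded xs ≤-refl))))))
    isP
  where
  length≤sum : ∀ {ys} → All (0 <_) ys → length ys ≤ sum ys
  length≤sum []       = z≤n
  length≤sum (p ∷ ps) = +-mono-≤ p (length≤sum ps)

  bounded : ∀ ys → sum ys ≤ k → VecAll.All (_∈ upTo (suc k)) (Vec.fromList ys)
  bounded []       _  = VecAll.[]
  bounded (y ∷ ys) le = ∈-upTo⁺ (s≤s (≤-trans (m≤m+n y (sum ys)) le))
                        VecAll.∷ bounded ys (≤-trans (m≤n+m (sum ys) y) le)

multiplicity : ℕ → List ℕ → ℕ
multiplicity y xs = length (filter (y ≟_) xs)

-- y < x are consecutive distinct part sizes of xs.
Consecutive : List ℕ → ℕ → ℕ → Set
Consecutive xs y x = y < x × (∀ {z} → z ∈ xs → z ≤ y ⊎ x ≤ z)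

-- 0 is not a part size, so the smallest part is unconstrained.
Steep : List ℕ → Set
Steep xs = ∀ {y} → y ∈ xs → ∀ {x} → x ∈ xs → Consecutive xs y x → multiplicity y xs ≤ x ∸ y

steep? : Decidable Steep
steep? xs = map′ (λ p {_} y∈ {_} x∈ → All.lookup (All.lookup p y∈) x∈)
                 (λ s → All.tabulate λ y∈ → All.tabulate λ x∈ → s y∈ x∈)
  (All.all? (λ y → All.all? (λ x → consecutive? y x →-dec (multiplicity y xs ≤? x ∸ y)) xs) xs)
  where
  consecutive? : ∀ y x → Dec (Consecutive xs y x)
  consecutive? y x = (y <? x) ×-dec
    map′ (λ p {_} z∈ → All.lookup p z∈) (λ f → All.tabulate f)
         (All.all? (λ z → (z ≤? y) ⊎-dec (x ≤? z)) xs)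

p : ℕ → ℕ
p k = length (partitions k)

steep : ℕ → ℕ
steep k = length (filter steep? (partitions k))

{-# OPTIONS --safe #-}
module Submission where

-- A permutation with few inversions, compared with its length n, has many cuts, i.e. positions t
-- whose first t entries are all smaller than the remaining ones.  If it avoids 1324, then the
-- entries between two cuts are increasing, so for n ≥ 2(k+1) a 1324-avoider with k inversions
-- is a direct sum α ⊕ β with |α| = k+1, where α avoids 132 and β avoids 213; conversely such
-- sums avoid 1324, and they avoid 2431 exactly when β does.
--
-- The reversal of β and the complement of α avoid 312.  Build a 312-avoider by inserting
-- 0, 1, 2, … in turn, and let f₀, f₁, … be the number of entries to the left of the inserted
-- maximum.  The word avoids 312 iff f is weakly increasing, and its ascending pairs
-- (the inversions of α and β) number f₀ + f₁ + ⋯ , so f is a partition padded by zeros.  The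
-- word also avoids 1342 (the reversal of 2431) iff this partition is steep: the entries inserted
-- at the same f > 0 form a decreasing run, preceded by f smaller entries, and the next, larger f
-- must not put the new maximum strictly inside this run.

open import Defs
open import Data.Bool using (true; false)
open import Data.List as List using (List; []; _∷_; [_]; _++_; length; map; reverse; take; drop; filter;
  replicate; downFrom; upTo; allFin; tabulate; concatMap; cartesianProduct; applyUpTo)
open import Data.List.Properties hiding (sum-++)
open import Data.List.Membership.Propositional using (_∈_; _∉_; find; lose)
open import Data.List.Membership.Propositional.Properties
open import Data.List.Relation.Unary.All as All using (All; []; _∷_)
import Data.List.Relation.Unary.All.Properties as All
open import Data.List.Relation.Unary.Any as Any using (Any; here; there)
open import Data.List.Relation.Unary.Linked as Linked using (Linked; []; [-]; _∷_)
import Data.List.Relation.Unary.Linked.Properties as Linked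
open import Data.List.Relation.Binary.Permutation.Propositional using
  (_↭_; ↭-refl; ↭-sym; ↭-trans; ↭-prep; ↭-reflexive; ↭⇒↭ₛ)
import Data.List.Relation.Binary.Permutation.Propositional.Properties as ↭
import Data.List.Relation.Binary.Permutation.Setoid.Properties as ↭ₛ
open import Data.List.Relation.Unary.Unique.Propositional using (Unique)
import Data.List.Relation.Unary.Unique.Propositional.Properties as Unique
open import Data.List.Relation.Binary.Sublist.Propositional using
  (_⊆_; []; _∷_; _∷ʳ_; ⊆-refl; ⊆-reflexive; ⊆-trans; minimum; from∈; to∈)
import Data.List.Relation.Binary.Sublist.Propositional.Properties as ⊆
open import Data.Fin as Fin using (Fin; zero; suc; toℕ; fromℕ<)
open import Data.Fin.Patterns using (0F; 1F; 2F; 3F)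
import Data.Fin.Properties as Fin
open import Data.List.Relation.Unary.AllPairs as AllPairs using (AllPairs; []; _∷_)
import Data.List.Relation.Unary.AllPairs.Properties as AllPairs
open import Data.Vec as Vec using (Vec; []; _∷_; lookup; toList; fromList)
import Data.Vec.Properties as Vec
import Data.Vec.Relation.Unary.All as VecAll
import Data.Vec.Relation.Unary.All.Properties as VecAll
open import Data.Vec.Relation.Unary.AllPairs using ([]; _∷_; allPairs?)
import Data.Vec.Relation.Unary.Unique.Propositional as Vec
open import Data.Nat
open import Data.Nat.Properties
open import Data.Nat.ListAction using (sum)
open import Data.Nat.ListAction.Properties using (sum-++)
open import Data.Product using (_×_; _,_; ∃; ∃₂; proj₁; proj₂)
open import Data.Sum using (_⊎_; inj₁; inj₂)
open import Level using (0ℓ)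
open import Function using (_∘_; id; _⇔_; mk⇔; Equivalence)
open import Relation.Binary.PropositionalEquality hiding ([_])
open import Relation.Unary using (Pred; Decidable)
open import Relation.Binary using (Rel; tri<; tri≈; tri>)
open import Relation.Nullary using (¬_; ¬?; _×-dec_; yes; no; contradiction)
open import Algebra.Properties.CommutativeSemigroup +-commutativeSemigroup using (interchange; x∙yz≈y∙xz)

private
  variable
    A B : Set
    f g k m n s t v : ℕ
    fs gs us vs ws xs ys : List ℕ

-- Pattern avoidance in words of naturals

Avoid₃ : (ℕ → ℕ → ℕ → Set) → List ℕ → Set
Avoid₃ R ws = ∀ {x y z} → x ∷ y ∷ z ∷ [] ⊆ ws → ¬ R x y z

Avoid₄ : (ℕ → ℕ → ℕ → ℕ → Set) → List ℕ → Set
Avoid₄ R ws = ∀ {w x y z} → w ∷ x ∷ y ∷ z ∷ [] ⊆ ws → ¬ R w x y z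

-- Variables are named by position, and the inequalities chain the letters by increasing value.
132-order 213-order 312-order : ℕ → ℕ → ℕ → Set
132-order x y z = x < z × z < y
213-order x y z = y < x × x < z
312-order x y z = y < z × z < x

1324-order 1342-order 2431-order : ℕ → ℕ → ℕ → ℕ → Set
1324-order w x y z = w < y × y < x × x < z
1342-order w x y z = w < z × z < x × x < y
2431-order w x y z = z < w × w < y × y < x

Decreasing : List ℕ → Set
Decreasing ws = ∀ {x y} → x ∷ y ∷ [] ⊆ ws → y < x

infix 4 _≪_
_≪_ : List ℕ → List ℕ → Set
us ≪ vs = ∀ {x y} → x ∈ us → y ∈ vs → x < y

⊆-++⁻ : ∀ (us : List A) {vs xs} → xs ⊆ us ++ vs →
        ∃₂ λ ps qs → xs ≡ ps ++ qs × ps ⊆ us × qs ⊆ vs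
⊆-++⁻ []       τ        = [] , _ , refl , [] , τ
⊆-++⁻ (u ∷ us) (.u ∷ʳ τ) with ps , qs , eq , σ , ρ ← ⊆-++⁻ us τ =
  ps , qs , eq , u ∷ʳ σ , ρ
⊆-++⁻ (u ∷ us) (refl ∷ τ) with ps , qs , refl , σ , ρ ← ⊆-++⁻ us τ =
  u ∷ ps , qs , refl , refl ∷ σ , ρ

-- The case split behind every insertion argument: an occurrence either survives from the word
-- without `v` or uses `v` at a known place.
⊆-delete : ∀ (us : List A) {v vs xs} → xs ⊆ us ++ v ∷ vs →
           xs ⊆ us ++ vs ⊎ ∃₂ λ ps qs → xs ≡ ps ++ v ∷ qs × ps ⊆ us × qs ⊆ vs
⊆-delete us τ with ⊆-++⁻ us τ
... | ps , qs , refl , σ , (_ ∷ʳ ρ) = inj₁ (⊆.++⁺ σ ρ)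
... | ps , _ , refl , σ , (refl ∷ ρ) = inj₂ (ps , _ , refl , σ , ρ)

⊆-insert : ∀ (us : List A) {v vs} → us ++ vs ⊆ us ++ v ∷ vs
⊆-insert us = ⊆.++⁺ (⊆-refl {x = us}) (_ ∷ʳ ⊆-refl)

⊆-map⁻ : ∀ {B : Set} (f : A → B) {xs} ys → xs ⊆ map f ys → ∃ λ zs → xs ≡ map f zs × zs ⊆ ys
⊆-map⁻ f []       []         = [] , refl , []
⊆-map⁻ f (y ∷ ys) (_ ∷ʳ τ) with zs , eq , σ ← ⊆-map⁻ f ys τ = zs , eq , y ∷ʳ σ
⊆-map⁻ f (y ∷ ys) (refl ∷ τ) with zs , refl , σ ← ⊆-map⁻ f ys τ = y ∷ zs , refl , refl ∷ σ

⊆-pair : ∀ {x y : A} {us vs} → x ∈ us → y ∈ vs → x ∷ y ∷ [] ⊆ us ++ vs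
⊆-pair x∈ y∈ = ⊆.++⁺ (from∈ x∈) (from∈ y∈)

-- Inserting a new maximum into an avoider

module _ (us : List ℕ) {vs : List ℕ} {v : ℕ} (bounded : ∀ {x} → x ∈ us ++ vs → x < v) where
  private
    u<v : ∀ {x} → x ∈ us → x < v
    u<v = bounded ∘ ∈-++⁺ˡ
    w<v : ∀ {x} → x ∈ vs → x < v
    w<v = bounded ∘ ∈-++⁺ʳ us

  -- The maximum can only play the 3, which comes first, so a new occurrence needs an ascending pair
  -- to its right.
  insert-max-312 : Avoid₃ 312-order (us ++ vs) → (∀ {x y} → x ∷ y ∷ [] ⊆ vs → ¬ x < y) →
                   Avoid₃ 312-order (us ++ v ∷ vs)
  insert-max-312 avoid dec τ (y<z , z<x) with ⊆-delete us τ
  ... | inj₁ σ = avoid σ (y<z , z<x)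
  ... | inj₂ ([] , _ , refl , _ , ρ) = dec ρ y<z
  ... | inj₂ (_ ∷ [] , _ , refl , _ , ρ) = <-asym y<z (w<v (to∈ ρ))
  ... | inj₂ (_ ∷ _ ∷ [] , _ , refl , σ , _) = <-asym z<x (u<v (to∈ σ))
  ... | inj₂ (_ ∷ _ ∷ _ ∷ [] , _ , () , _)
  ... | inj₂ (_ ∷ _ ∷ _ ∷ _ ∷ _ , _ , () , _)

  insert-max-312⁻ : Avoid₃ 312-order (us ++ v ∷ vs) →
                    ∀ {x y} → x ∷ y ∷ [] ⊆ vs → ¬ x < y
  insert-max-312⁻ avoid τ x<y =
    avoid (⊆.++⁺ˡ us (refl ∷ τ)) (x<y , w<v (to∈ (⊆-trans (_ ∷ʳ ⊆-refl) τ)))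

  -- The maximum can only play the 4, so the 1 and the 3 lie to its left and the 2 to its right.
  insert-max-1342 : Avoid₄ 1342-order (us ++ vs) →
                    (∀ {a b d} → a ∷ b ∷ [] ⊆ us → d ∈ vs → ¬ (a < d × d < b)) →
                    Avoid₄ 1342-order (us ++ v ∷ vs)
  insert-max-1342 avoid ok τ (w<z , z<x , x<y) with ⊆-delete us τ
  ... | inj₁ σ = avoid σ (w<z , z<x , x<y)
  ... | inj₂ ([] , _ , refl , _ , ρ) = <-asym w<z (w<v (to∈ (⊆-trans (_ ∷ʳ _ ∷ʳ ⊆-refl) ρ)))
  ... | inj₂ (_ ∷ [] , _ , refl , _ , ρ) = <-asym x<y (w<v (to∈ ρ))
  ... | inj₂ (_ ∷ _ ∷ [] , _ , refl , σ , ρ) = ok σ (to∈ ρ) (w<z , z<x)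
  ... | inj₂ (_ ∷ _ ∷ _ ∷ [] , _ , refl , σ , _) = <-asym z<x (u<v (to∈ (⊆-trans (_ ∷ʳ ⊆-refl) σ)))
  ... | inj₂ (_ ∷ _ ∷ _ ∷ _ ∷ [] , _ , () , _)
  ... | inj₂ (_ ∷ _ ∷ _ ∷ _ ∷ _ ∷ _ , _ , () , _)

  insert-max-1342⁻ : Avoid₄ 1342-order (us ++ v ∷ vs) →
                     ∀ {a b d} → a ∷ b ∷ [] ⊆ us → d ∈ vs → ¬ (a < d × d < b)
  insert-max-1342⁻ avoid σ d∈ (a<d , d<b) =
    avoid (⊆.++⁺ σ (refl ∷ from∈ d∈)) (a<d , d<b , u<v (to∈ (⊆-trans (_ ∷ʳ ⊆-refl) σ)))


-- Prefixes, heads and multiplicities in lists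

take-++ : ∀ (us : List A) {vs} j → take (length us + j) (us ++ vs) ≡ us ++ take j vs
take-++ []       j = refl
take-++ (u ∷ us) j = cong (u ∷_) (take-++ us j)

drop-++ : ∀ (us : List A) {vs} j → drop (length us + j) (us ++ vs) ≡ drop j vs
drop-++ []       j = refl
drop-++ (u ∷ us) j = drop-++ us j

splitAt-++ : ∀ (us : List A) {vs} → length us ≡ n → take n (us ++ vs) ≡ us × drop n (us ++ vs) ≡ vs
splitAt-++ []       refl = refl , refl
splitAt-++ (u ∷ us) refl with t , d ← splitAt-++ us refl = cong (u ∷_) t , d

drop-⊆-++ : ∀ (us : List A) {vs} → length us ≤ n → drop n (us ++ vs) ⊆ vs
drop-⊆-++ {n = n} []   _         = ⊆.drop-⊆ n _
drop-⊆-++ (u ∷ us)     (s≤s len) = drop-⊆-++ us len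

nonempty⇒∈ : ∀ {xs : List A} → 0 < length xs → ∃ (_∈ xs)
nonempty⇒∈ {xs = x ∷ _} _ = x , here refl

length-take-≤ : ∀ n (xs : List A) → n ≤ length xs → length (take n xs) ≡ n
length-take-≤ n xs n≤ = trans (length-take n xs) (m≤n⇒m⊓n≡m n≤)

-- The default 0 treats the empty list like a list of padding zeros.
hd : List ℕ → ℕ
hd []      = 0
hd (x ∷ _) = x

hd-≤ : ∀ {x xs} → Linked _≥_ (x ∷ xs) → hd xs ≤ x
hd-≤ [-]      = z≤n
hd-≤ (ge ∷ _) = ge

linked-∷ : ∀ {x xs} → hd xs ≤ x → Linked _≥_ xs → Linked _≥_ (x ∷ xs)
linked-∷ {xs = []}    _  _ = [-]
linked-∷ {xs = _ ∷ _} le l = le ∷ l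

all-≤-hd : Linked _≥_ xs → All (_≤ hd xs) xs
all-≤-hd {[]}    _ = []
all-≤-hd {_ ∷ _} l = Linked.Linked⇒All (λ p q → ≤-trans q p) ≤-refl l

multiplicity-> : All (_< v) xs → multiplicity v xs ≡ 0
multiplicity-> xs<v = cong length (filter-none (_ ≟_) (All.map (λ x<v v≡x → <⇒≢ x<v (sym v≡x)) xs<v))

multiplicity-∷ : ∀ x xs → multiplicity x (x ∷ xs) ≡ suc (multiplicity x xs)
multiplicity-∷ x xs = cong length (filter-accept (x ≟_) refl)

-- Words built from insertion codes

-- A code lists the insertion positions from the last one back to the first.
build : List ℕ → List ℕ
build []       = []
build (f ∷ fs) = take f (build fs) ++ length fs ∷ drop f (build fs)

-- Since `take` truncates, `build` accepts any list; validity makes each entry the true number of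
-- letters to the left of the inserted one.
data Valid : List ℕ → Set where
  []  : Valid []
  _∷_ : f ≤ length fs → Valid fs → Valid (f ∷ fs)

build-↭ : ∀ fs → build fs ↭ downFrom (length fs)
build-↭ []       = ↭-refl
build-↭ (f ∷ fs) = ↭-trans (↭.shift (length fs) (take f (build fs)) (drop f (build fs)))
  (↭-prep _ (subst (_↭ _) (sym (take++drop≡id f (build fs))) (build-↭ fs)))

length-build : ∀ fs → length (build fs) ≡ length fs
length-build fs = trans (↭.↭-length (build-↭ fs)) (length-downFrom _)

build-bounded : ∀ fs {x} → x ∈ build fs → x < length fs
build-bounded fs x∈ = ∈-downFrom⁻ (↭.∈-resp-↭ (build-↭ fs) x∈)

split-bounded : ∀ f fs {x} → x ∈ take f (build fs) ++ drop f (build fs) → x < length fs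
split-bounded f fs = build-bounded fs ∘ subst (_ ∈_) (take++drop≡id f (build fs))

tail-build-⊆ : ∀ f fs → build fs ⊆ build (f ∷ fs)
tail-build-⊆ f fs = ⊆-trans (⊆-reflexive (sym (take++drop≡id f (build fs)))) (⊆-insert (take f (build fs)))

length-take-build : ∀ f fs → f ≤ length fs → length (take f (build fs)) ≡ f
length-take-build f fs f≤ = length-take-≤ f (build fs) (subst (f ≤_) (sym (length-build fs)) f≤)

-- 312-avoidance and monotone codes

decreasing-∷ : (∀ {x} → x ∈ ws → x < v) → Decreasing ws → Decreasing (v ∷ ws)
decreasing-∷ bounded dec (_ ∷ʳ τ)   = dec τ
decreasing-∷ bounded dec (refl ∷ τ) = bounded (to∈ τ)

-- By induction: beyond position `f` there remain at most the new maximum and, after it, the old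
-- suffix from `f`, which is already decreasing.
linked⇒decreasing : ∀ fs → Linked _≥_ fs → hd fs ≤ g → Decreasing (drop g (build fs))
linked⇒decreasing {g} [] _ _ τ with () ← subst (_ ∷ _ ∷ [] ⊆_) (drop-[] g) τ
linked⇒decreasing {g} (f ∷ fs) l f≤g τ =
  decreasing-∷ (split-bounded f fs ∘ ∈-++⁺ʳ (take f (build fs)))
               (linked⇒decreasing fs (Linked.tail l) (hd-≤ l))
               (⊆-trans τ (drop-⊆-++ (take f (build fs)) (≤-trans len f≤g)))
  where
  len : length (take f (build fs)) ≤ f
  len = subst (_≤ f) (sym (length-take f (build fs))) (m⊓n≤m f _)

linked⇒312-avoiding : ∀ fs → Linked _≥_ fs → Avoid₃ 312-order (build fs)
linked⇒312-avoiding []       l ()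
linked⇒312-avoiding (f ∷ fs) l = insert-max-312 (take f (build fs)) (split-bounded f fs)
  (subst (Avoid₃ 312-order) (sym (take++drop≡id f (build fs))) (linked⇒312-avoiding fs (Linked.tail l)))
  (λ τ → <-asym (linked⇒decreasing fs (Linked.tail l) (hd-≤ l) τ))

drop-pair : ∀ (us : List A) {v vs} → n < length us → ∃ λ x → x ∈ us × x ∷ v ∷ [] ⊆ drop n (us ++ v ∷ vs)
drop-pair {n = zero}  (u ∷ us) _       = u , here refl , refl ∷ ⊆.++⁺ˡ us (refl ∷ minimum _)
drop-pair {n = suc _} (u ∷ us) (s≤s lt) with x , x∈ , τ ← drop-pair us lt = x , there x∈ , τ

-- If `f` were smaller than the previous position `g`, the previous maximum and some smaller letter
-- before it would both lie to the right of the new maximum, as the 2 and the 1 of a 312.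
312-avoiding⇒hd-≤ : Valid fs → Avoid₃ 312-order (build (f ∷ fs)) → hd fs ≤ f
312-avoiding⇒hd-≤ [] _ = z≤n
312-avoiding⇒hd-≤ {fs@(g ∷ gs)} {f} (g≤ ∷ _) avoid with g ≤? f
... | yes g≤f = g≤f
... | no g≰f with x , x∈ , τ ←
  drop-pair (take g (build gs)) (subst (f <_) (sym (length-take-build g gs g≤)) (≰⇒> g≰f)) =
  contradiction (split-bounded g gs (∈-++⁺ˡ x∈))
                (insert-max-312⁻ (take f (build fs)) (split-bounded f fs) avoid τ)

312-avoiding⇒linked : Valid fs → Avoid₃ 312-order (build fs) → Linked _≥_ fs
312-avoiding⇒linked [] _ = []
312-avoiding⇒linked {f ∷ fs} (_ ∷ valid) avoid =
  linked-∷ (312-avoiding⇒hd-≤ valid avoid)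
           (312-avoiding⇒linked valid (avoid ∘ λ τ → ⊆-trans τ (tail-build-⊆ f fs)))

-- 1342-avoidance and steep codes

-- In a weakly decreasing list it suffices to look where the value drops from `f` to `hd fs`: all
-- copies of the smaller part are then still in `fs`. The guard `0 < hd fs` exempts the padding
-- zeros, which are not parts.
data LocallySteep : List ℕ → Set where
  []  : LocallySteep []
  _∷_ : (0 < hd fs → hd fs < f → multiplicity (hd fs) fs ≤ f ∸ hd fs) → LocallySteep fs → LocallySteep (f ∷ fs)

data Shape (fs ws : List ℕ) : Set where
  flat : hd fs ≡ 0 → Decreasing ws → Shape fs ws
  -- vs is the run of entries inserted at the current position hd fs.
  bump : ∀ ps vs ds → ws ≡ ps ++ vs ++ ds →
         length ps ≡ hd fs → length vs ≡ multiplicity (hd fs) fs →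
         Decreasing vs → Decreasing ds → ps ≪ vs → ds ≪ ps ++ vs → Shape fs ws

module Insertion {f : ℕ} {fs : List ℕ} (f≤ : f ≤ length fs) (linked : Linked _≥_ (f ∷ fs)) where
  private
    W = build fs
    L = take f W
    R = drop f W

    L<v : ∀ {x} → x ∈ L → x < length fs
    L<v = split-bounded f fs ∘ ∈-++⁺ˡ
    R<v : ∀ {x} → x ∈ R → x < length fs
    R<v = split-bounded f fs ∘ ∈-++⁺ʳ L

  -- The condition in `insert-max-1342`: it says that the insertion at `f` creates no 1342.
  Harmless : Set
  Harmless = ∀ {a b d} → a ∷ b ∷ [] ⊆ L → d ∈ R → ¬ (a < d × d < b)

  -- The insertion point falls in the decreasing tail `ds`, so `R` is an end piece of `ds`, and `L`
  -- consists of `us` and of larger letters of `ds`.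
  insert-below : ∀ us ds → W ≡ us ++ ds → length us ≤ f → Decreasing ds → ds ≪ us →
                 Decreasing R × R ≪ L
  insert-below us ds eq len dec ds≪us = dec′ , R≪L
    where
    j = f ∸ length us
    f≡ : length us + j ≡ f
    f≡ = m+[n∸m]≡n len
    L≡ : L ≡ us ++ take j ds
    L≡ = trans (cong₂ take (sym f≡) eq) (take-++ us j)
    R≡ : R ≡ drop j ds
    R≡ = trans (cong₂ drop (sym f≡) eq) (drop-++ us j)
    dec′ : Decreasing R
    dec′ τ = dec (⊆-trans τ (subst (_⊆ ds) (sym R≡) (⊆.drop-⊆ j ds)))
    R≪L : R ≪ L
    R≪L {x} {y} x∈ y∈ with x∈′ ← subst (x ∈_) R≡ x∈ | ∈-++⁻ us (subst (y ∈_) L≡ y∈)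
    ... | inj₁ y∈us = ds≪us (subst (x ∈_) (take++drop≡id j ds) (∈-++⁺ʳ (take j ds) x∈′)) y∈us
    ... | inj₂ y∈   = dec (subst (_ ∷ _ ∷ [] ⊆_) (take++drop≡id j ds) (⊆-pair y∈ x∈′))

  -- A 2 to the right of the new maximum would have to exceed a 1 to its left, which `R ≪ L`
  -- forbids. If `f` is positive, the new maximum starts a run of its own with prefix `L`.
  shape-below : hd fs < f ⊎ f ≡ 0 → Decreasing R × R ≪ L → Shape (f ∷ fs) (build (f ∷ fs)) × Harmless
  shape-below hd<f (dec , R≪L) = shape hd<f , λ σ d∈ (a<d , _) → <-asym a<d (R≪L d∈ (to∈ (⊆-trans (refl ∷ minimum _) σ)))
    where
    R≪L′ : R ≪ L ++ [ length fs ]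
    R≪L′ x∈ y∈ with ∈-++⁻ L y∈
    ... | inj₁ y∈L         = R≪L x∈ y∈L
    ... | inj₂ (here refl) = R<v x∈
    shape : hd fs < f ⊎ f ≡ 0 → Shape (f ∷ fs) (build (f ∷ fs))
    shape (inj₂ refl) = flat refl (decreasing-∷ R<v dec)
    shape (inj₁ hd<f) = bump L [ length fs ] R refl (length-take-build f fs f≤)
      -- All earlier entries are below `f`, so the run at `f` has length 1.
      (sym (trans (multiplicity-∷ f fs)
                  (cong suc (multiplicity-> (All.map (λ le → ≤-<-trans le hd<f) (all-≤-hd (Linked.tail linked)))))))
      (λ { (_ ∷ʳ ()) ; (_ ∷ ()) }) dec (λ { x∈ (here refl) → L<v x∈ }) R≪L′

  -- Either the position is repeated and the new maximum goes to the front of the run, or it jumps,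
  -- and steepness makes it land at or beyond the end of the run, in the decreasing tail.
  shape-insert : (0 < hd fs → hd fs < f → multiplicity (hd fs) fs ≤ f ∸ hd fs) →
                 Shape fs W → Shape (f ∷ fs) (build (f ∷ fs)) × Harmless
  shape-insert steep (flat hd≡0 dec) =
    shape-below 0<f⊎f≡0 (insert-below [] W refl z≤n dec (λ _ ()))
    where
    0<f⊎f≡0 : hd fs < f ⊎ f ≡ 0
    0<f⊎f≡0 with f ≟ 0
    ... | yes f≡0 = inj₂ f≡0
    ... | no  f≢0 = inj₁ (subst (_< f) (sym hd≡0) (n≢0⇒n>0 f≢0))
  shape-insert steep (bump ps vs ds eq lenP lenV decV decD ps≪vs ds≪) with hd fs ≟ f
  ... | yes refl = bump ps (length fs ∷ vs) ds eq′ lenP (trans (cong suc lenV) (sym (multiplicity-∷ f fs)))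
                     (decreasing-∷ (R<v ∘ subst (_ ∈_) (sym R≡) ∘ ∈-++⁺ˡ) decV) decD ps≪v∷vs ds≪′
                 , harmless
    where
    L≡ : L ≡ ps
    L≡ = trans (cong (take f) eq) (proj₁ (splitAt-++ ps lenP))
    R≡ : R ≡ vs ++ ds
    R≡ = trans (cong (drop f) eq) (proj₂ (splitAt-++ ps lenP))
    eq′ : build (f ∷ fs) ≡ ps ++ length fs ∷ vs ++ ds
    eq′ = cong₂ (λ us ws → us ++ length fs ∷ ws) L≡ R≡
    ps≪v∷vs : ps ≪ length fs ∷ vs
    ps≪v∷vs x∈ (here refl) = L<v (subst (_ ∈_) (sym L≡) x∈)
    ps≪v∷vs x∈ (there y∈)  = ps≪vs x∈ y∈
    ds≪′ : ds ≪ ps ++ length fs ∷ vs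
    ds≪′ x∈ y∈ with ∈-++⁻ ps y∈
    ... | inj₁ y∈ps        = ds≪ x∈ (∈-++⁺ˡ y∈ps)
    ... | inj₂ (here refl) = R<v (subst (_ ∈_) (sym R≡) (∈-++⁺ʳ vs x∈))
    ... | inj₂ (there y∈vs) = ds≪ x∈ (∈-++⁺ʳ ps y∈vs)
    harmless : Harmless
    -- A 2 taken from the run exceeds the supposed 3 in `ps`; one taken from the tail is below the
    -- supposed 1.
    harmless σ d∈ (a<d , d<b) with σ′ ← subst (_ ∷ _ ∷ [] ⊆_) L≡ σ | ∈-++⁻ vs (subst (_ ∈_) R≡ d∈)
    ... | inj₁ d∈vs = <-asym d<b (ps≪vs (to∈ (⊆-trans (_ ∷ʳ ⊆-refl) σ′)) d∈vs)
    ... | inj₂ d∈ds = <-asym a<d (ds≪ d∈ds (∈-++⁺ˡ (to∈ (⊆-trans (refl ∷ minimum _) σ′))))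
  ... | no hd≢f = shape-below (inj₁ hd<f) below
    where
    hd<f : hd fs < f
    hd<f = ≤∧≢⇒< (hd-≤ linked) hd≢f
    below : Decreasing R × R ≪ L
    below with hd fs ≟ 0
    -- With head 0 every insertion took place at the front, so the whole word is decreasing.
    ... | yes hd≡0 = insert-below [] W refl z≤n
                       (linked⇒decreasing {0} fs (Linked.tail linked) (≤-reflexive hd≡0)) (λ _ ())
    ... | no hd≢0 = insert-below (ps ++ vs) ds (trans eq (sym (++-assoc ps vs ds))) len decD ds≪
      where
      len : length (ps ++ vs) ≤ f
      len = begin
        length (ps ++ vs)                  ≡⟨ length-++ ps ⟩
        length ps + length vs              ≡⟨ cong₂ _+_ lenP lenV ⟩
        -- Steepness enters here: the run starts at position `hd fs`, and a jump of at least its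
        -- length clears it.
        hd fs + multiplicity (hd fs) fs    ≤⟨ +-monoʳ-≤ (hd fs) (steep (n≢0⇒n>0 hd≢0) hd<f) ⟩
        hd fs + (f ∸ hd fs)                ≡⟨ m+[n∸m]≡n (<⇒≤ hd<f) ⟩
        f                                  ∎
        where open ≤-Reasoning

  -- A jump from hd fs to f shorter than the run of hd fs puts the new maximum inside the
  -- run, where it plays the 4 of a 1342.
  shape⇒steep : Shape fs W → Harmless → 0 < hd fs → hd fs < f → multiplicity (hd fs) fs ≤ f ∸ hd fs
  shape⇒steep (flat hd≡0 _) _ 0<hd _ = contradiction hd≡0 (>⇒≢ 0<hd)
  shape⇒steep (bump ps vs ds eq lenP lenV decV _ ps≪vs _) harmless 0<hd hd<f
    with multiplicity (hd fs) fs ≤? f ∸ hd fs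
  ... | yes le = le
  ... | no ≰
    with k<len ← subst (f ∸ hd fs <_) (sym lenV) (≰⇒> ≰)
    with lenK ← length-take-≤ (f ∸ hd fs) vs (<⇒≤ k<len)
    -- The 1 comes from the prefix, the 3 from the part of the run before the new maximum and the 2
    -- from the part after it.
    with a , a∈ ← nonempty⇒∈ (subst (0 <_) (sym lenP) 0<hd)
       | b , b∈ ← nonempty⇒∈ (subst (0 <_) (sym lenK) (m<n⇒0<n∸m hd<f))
       | d , d∈ ← nonempty⇒∈ (subst (0 <_) (sym (length-drop (f ∸ hd fs) vs)) (m<n⇒0<n∸m k<len))
    = contradiction
        ( ps≪vs a∈ (⊆.Any-resp-⊆ (⊆.drop-⊆ j vs) d∈)
        , decV (subst (_ ∷ _ ∷ [] ⊆_) (take++drop≡id j vs) (⊆-pair b∈ d∈)))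
        (harmless (subst (_ ∷ _ ∷ [] ⊆_) (sym (proj₁ split)) (⊆-pair a∈ b∈))
                  (subst (d ∈_) (sym (proj₂ split)) (∈-++⁺ˡ d∈)))
    where
    j = f ∸ hd fs
    len : length (ps ++ take j vs) ≡ f
    len = trans (length-++ ps)
      (trans (cong₂ _+_ lenP (length-take-≤ j vs (<⇒≤ (subst (j <_) (sym lenV) (≰⇒> ≰)))))
             (m+[n∸m]≡n (<⇒≤ hd<f)))
    W≡ : W ≡ (ps ++ take j vs) ++ drop j vs ++ ds
    W≡ = begin
      W                                       ≡⟨ eq ⟩
      ps ++ vs ++ ds                          ≡⟨ cong (λ ws → ps ++ ws ++ ds) (take++drop≡id j vs) ⟨
      ps ++ (take j vs ++ drop j vs) ++ ds    ≡⟨ cong (ps ++_) (++-assoc (take j vs) _ ds) ⟩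
      ps ++ take j vs ++ drop j vs ++ ds      ≡⟨ ++-assoc ps _ _ ⟨
      (ps ++ take j vs) ++ drop j vs ++ ds    ∎
      where open ≡-Reasoning
    split : L ≡ ps ++ take j vs × R ≡ drop j vs ++ ds
    split with t , d ← splitAt-++ (ps ++ take j vs) {drop j vs ++ ds} len =
      trans (cong (take f) W≡) t , trans (cong (drop f) W≡) d

open Insertion

shape : Valid fs → Linked _≥_ fs → LocallySteep fs → Shape fs (build fs)
shape []           _ _         = flat refl λ ()
shape (f≤ ∷ valid) l (st ∷ ls) = proj₁ (shape-insert f≤ l st (shape valid (Linked.tail l) ls))

steep⇒1342-avoiding : Valid fs → Linked _≥_ fs → LocallySteep fs → Avoid₄ 1342-order (build fs)
steep⇒1342-avoiding [] _ _ ()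
steep⇒1342-avoiding {f ∷ fs} (f≤ ∷ valid) l (st ∷ ls) =
  insert-max-1342 (take f (build fs)) (split-bounded f fs)
    (subst (Avoid₄ 1342-order) (sym (take++drop≡id f (build fs))) (steep⇒1342-avoiding valid (Linked.tail l) ls))
    (proj₂ (shape-insert f≤ l st (shape valid (Linked.tail l) ls)))

-- The word of the shorter code is a subword, so that code is steep by induction and its shape is
-- known, which is what `shape⇒steep` requires.
1342-avoiding⇒steep : Valid fs → Linked _≥_ fs → Avoid₄ 1342-order (build fs) → LocallySteep fs
1342-avoiding⇒steep [] _ _ = []
1342-avoiding⇒steep {f ∷ fs} (f≤ ∷ valid) l avoid =
  shape⇒steep f≤ l (shape valid (Linked.tail l) ls)
    (insert-max-1342⁻ (take f (build fs)) (split-bounded f fs) avoid) ∷ ls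
  where
  ls : LocallySteep fs
  ls = 1342-avoiding⇒steep valid (Linked.tail l) (avoid ∘ λ τ → ⊆-trans τ (tail-build-⊆ f fs))

-- Ascending pairs and inversions

asc inv : List ℕ → ℕ
asc []       = 0
asc (x ∷ xs) = length (filter (x <?_) xs) + asc xs
inv []       = 0
inv (x ∷ xs) = length (filter (_<? x) xs) + inv xs

-- The maximum is the upper end of an ascending pair with each letter to its left and the lower end
-- of none.
asc-insert-max : ∀ us {vs} → (∀ {x} → x ∈ us ++ vs → x < v) → asc (us ++ v ∷ vs) ≡ length us + asc (us ++ vs)
asc-insert-max {v} [] {vs} bounded =
  cong (λ ws → length ws + asc vs) (filter-none (v <?_) (All.tabulate λ x∈ → <-asym (bounded x∈)))
asc-insert-max {v} (u ∷ us) {vs} bounded = begin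
  length (filter (u <?_) (us ++ v ∷ vs)) + asc (us ++ v ∷ vs)
    ≡⟨ cong₂ _+_ (↭.↭-length (↭.filter-↭ (u <?_) (↭.shift v us vs))) (asc-insert-max us (bounded ∘ there)) ⟩
  length (filter (u <?_) (v ∷ us ++ vs)) + (length us + asc (us ++ vs))
    ≡⟨ cong (λ ws → length ws + _) (filter-accept (u <?_) (bounded (here refl))) ⟩
  suc (c + (length us + asc (us ++ vs)))
    ≡⟨ cong suc (x∙yz≈y∙xz c (length us) _) ⟩
  suc (length us + (c + asc (us ++ vs))) ∎
  where
  open ≡-Reasoning
  c = length (filter (u <?_) (us ++ vs))

asc-build : Valid fs → asc (build fs) ≡ sum fs
asc-build [] = refl
asc-build {f ∷ fs} (f≤ ∷ valid) = trans (asc-insert-max (take f (build fs)) (split-bounded f fs))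
  (cong₂ _+_ (length-take-build f fs f≤)
    (trans (cong asc (take++drop≡id f (build fs))) (asc-build valid)))

-- Bijectivity of the encoding

-- Delete the maximum: the number of letters to its left is the last insertion position, and the
-- rest is encoded by induction.
build-surjective : ∀ n {ws} → ws ↭ downFrom n → ∃ λ fs → length fs ≡ n × Valid fs × build fs ≡ ws
build-surjective zero ws↭ with refl ← ↭.↭-empty-inv ws↭ = [] , refl , [] , refl
build-surjective (suc n) ws↭
  with us , vs , refl ← ∈-∃++ (↭.∈-resp-↭ (↭-sym ws↭) (here refl))
  with us++vs↭ ← ↭.drop-mid us [] ws↭
  with fs , refl , valid , eq ← build-surjective n us++vs↭
  with t , d ← splitAt-++ us {vs} refl
  = length us ∷ fs , refl
  , subst (length us ≤_) (trans (sym (cong length eq)) (length-build fs))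
      (subst (length us ≤_) (sym (length-++ us)) (m≤m+n _ _)) ∷ valid
  , cong₂ (λ as bs → as ++ n ∷ bs) (trans (cong (take (length us)) eq) t)
                                   (trans (cong (drop (length us)) eq) d)

-- `v` is absent from both prefixes, so its first occurrence marks the same place on both sides.
insert-injective : ∀ (us us′ : List A) {v vs vs′} → v ∉ us → v ∉ us′ →
                   us ++ v ∷ vs ≡ us′ ++ v ∷ vs′ → us ≡ us′ × vs ≡ vs′
insert-injective []       []        _ _ refl = refl , refl
insert-injective []       (_ ∷ _)   _ v∉ refl = contradiction (here refl) v∉
insert-injective (_ ∷ _)  []        v∉ _ refl = contradiction (here refl) v∉
insert-injective (u ∷ us) (u′ ∷ us′) v∉ v∉′ eq with refl , eq′ ← ∷-injective eq
  with refl , refl ← insert-injective us us′ (v∉ ∘ there) (v∉′ ∘ there) eq′ = refl , refl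

build-injective : Valid fs → Valid gs → length fs ≡ length gs → build fs ≡ build gs → fs ≡ gs
build-injective [] [] _ _ = refl
build-injective {f ∷ fs} {g ∷ gs} (f≤ ∷ vf) (g≤ ∷ vg) len eq
  with l≡ ← suc-injective len
  with t≡ , d≡ ← insert-injective (take f (build fs)) (take g (build gs))
         (λ v∈ → <-irrefl refl (split-bounded f fs (∈-++⁺ˡ v∈)))
         (λ v∈ → <-irrefl l≡ (split-bounded g gs (∈-++⁺ˡ v∈)))
         (trans eq (cong (λ v → take g (build gs) ++ v ∷ drop g (build gs)) (sym l≡)))
  = cong₂ _∷_
      (trans (sym (length-take-build f fs f≤)) (trans (cong length t≡) (length-take-build g gs g≤)))
      (build-injective vf vg l≡
        (trans (sym (take++drop≡id f (build fs))) (trans (cong₂ _++_ t≡ d≡) (take++drop≡id g (build gs)))))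


-- Cuts of permutations with few inversions

unique-↭ : {xs ys : List A} → xs ↭ ys → Unique xs → Unique ys
unique-↭ {A} xs↭ys = ↭ₛ.Unique-resp-↭ (setoid A) (↭⇒↭ₛ xs↭ys)

unique-pair : ∀ {x y : A} {ws} → Unique ws → x ∷ y ∷ [] ⊆ ws → x ≢ y
unique-pair (_ ∷ u) (_ ∷ʳ τ)   refl = unique-pair u τ refl
unique-pair (x∉ ∷ _) (refl ∷ τ) refl = All.lookup x∉ (to∈ τ) refl

-- A cut t of w fails to be a cut of x ∷ w, shifted by one, only if x exceeds some entry after
-- the cut, hence also all t entries before it.
cut : ∀ {ws} → Unique ws → ∀ a → ∃ λ t → a ≤ t × t ≤ a + inv ws × take t ws ≪ drop t ws
cut {[]} _ a = a , ≤-refl , m≤m+n a 0 , λ x∈ → contradiction (subst (_ ∈_) (take-[] a) x∈) λ ()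
cut {x ∷ ws} _ zero = 0 , z≤n , z≤n , λ ()
cut {x ∷ ws} (x∉ ∷ unique) (suc a)
  -- Starting at `a` plus the number of letters below `x` leaves too few such letters for all `t`
  -- letters before the cut and one more after it.
  with t , ≤t , t≤ , ll ← cut unique (a + length (filter (_<? x) ws))
  = suc t , s≤s (m+n≤o⇒m≤o a ≤t) , s≤s (subst (t ≤_) (+-assoc a _ _) t≤) , cuts
  where
  cuts : x ∷ take t ws ≪ drop t ws
  cuts (there u∈)  y∈ = ll u∈ y∈
  cuts {y = y} (here refl) y∈ with x <? y
  ... | yes x<y = x<y
  ... | no  x≮y = contradiction (m+n≤o⇒n≤o a ≤t) (<⇒≱ (begin-strict
      t ≡⟨ length-take-≤ t ws t≤len ⟨
      length (take t ws) ≡⟨ cong length (filter-all (_<? x) (All.tabulate λ u∈ → <-trans (ll u∈ y∈) y<x)) ⟨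
      length (filter (_<? x) (take t ws)) <⟨ m<m+n _ (filter-some (_<? x) (Any.map (λ { refl → y<x }) y∈)) ⟩
      length (filter (_<? x) (take t ws)) + length (filter (_<? x) (drop t ws))
        ≡⟨ length-++ (filter (_<? x) (take t ws)) ⟨
      length (filter (_<? x) (take t ws) ++ filter (_<? x) (drop t ws))
        ≡⟨ cong length (filter-++ (_<? x) (take t ws) (drop t ws)) ⟨
      length (filter (_<? x) (take t ws ++ drop t ws))
        ≡⟨ cong (length ∘ filter (_<? x)) (take++drop≡id t ws) ⟩
      length (filter (_<? x) ws) ∎))
    where
    open ≤-Reasoning
    y<x : y < x
    y<x = ≤∧≢⇒< (≮⇒≥ x≮y) λ { refl → All.lookup x∉ (⊆.Any-resp-⊆ (⊆.drop-⊆ t ws) y∈) refl }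
    t≤len : t ≤ length ws
    t≤len with t ≤? length ws
    ... | yes le = le
    ... | no ≰ with () ← subst (y ∈_) (drop-all t ws (<⇒≤ (≰⇒> ≰))) y∈

-- A descent across the middle point, with `a` before it as the 1 and `c` after it as the 4, would
-- be a 1324.
middle-cut : ∀ as ms₁ ms₂ {cs a c} → Unique (as ++ ms₁ ++ ms₂ ++ cs) → Avoid₄ 1324-order (as ++ ms₁ ++ ms₂ ++ cs) →
             as ≪ ms₁ ++ ms₂ ++ cs → as ++ ms₁ ++ ms₂ ≪ cs → a ∈ as → c ∈ cs → as ++ ms₁ ≪ ms₂ ++ cs
middle-cut as ms₁ ms₂ {cs} unique avoid as≪ ≪cs a∈ c∈ {x} {y} x∈ y∈
  with ∈-++⁻ as x∈ | ∈-++⁻ ms₂ y∈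
... | inj₁ x∈as | _          = as≪ x∈as (∈-++⁺ʳ ms₁ y∈)
... | inj₂ x∈ms | inj₂ y∈cs  = ≪cs (∈-++⁺ʳ as (∈-++⁺ˡ x∈ms)) y∈cs
... | inj₂ x∈ms | inj₁ y∈ms with x <? y
...   | yes x<y = x<y
...   | no x≮y = contradiction
  ( as≪ a∈ (∈-++⁺ʳ ms₁ (∈-++⁺ˡ y∈ms))
  , ≤∧≢⇒< (≮⇒≥ x≮y) (≢-sym (unique-pair unique (⊆.++⁺ˡ as (⊆-pair x∈ms (∈-++⁺ˡ y∈ms)))))
  , ≪cs (∈-++⁺ʳ as (∈-++⁺ˡ x∈ms)) c∈ )
  (avoid (⊆.++⁺ (from∈ a∈) (⊆.++⁺ (from∈ x∈ms) (⊆-pair y∈ms c∈))))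

-- Inversions under sums, reversal, shifts and complements

module _ {P : Pred A 0ℓ} {Q : Pred B 0ℓ} (P? : Decidable P) (Q? : Decidable Q) (h : A → B) where
  length-filter-map : ∀ xs → (∀ {x} → x ∈ xs → P x ⇔ Q (h x)) →
                      length (filter Q? (map h xs)) ≡ length (filter P? xs)
  length-filter-map [] _ = refl
  length-filter-map (x ∷ xs) eqv with ih ← length-filter-map xs (eqv ∘ there) | P? x | Q? (h x)
  ... | yes _ | yes _ = cong suc ih
  ... | no _  | no _  = ih
  ... | yes px | no ¬q = contradiction (Equivalence.to (eqv (here refl)) px) ¬q
  ... | no ¬p | yes q  = contradiction (Equivalence.from (eqv (here refl)) q) ¬p

inv-++ : ∀ us {vs} → us ≪ vs → inv (us ++ vs) ≡ inv us + inv vs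
inv-++ [] _ = refl
inv-++ (u ∷ us) {vs} us≪vs = begin
  length (filter (_<? u) (us ++ vs)) + inv (us ++ vs)
    ≡⟨ cong₂ _+_ (cong length (filter-++ (_<? u) us vs)) (inv-++ us (us≪vs ∘ there)) ⟩
  length (filter (_<? u) us ++ filter (_<? u) vs) + (inv us + inv vs)
    ≡⟨ cong (λ ws → length (filter (_<? u) us ++ ws) + _)
         (filter-none (_<? u) (All.tabulate λ y∈ → <-asym (us≪vs (here refl) y∈))) ⟩
  length (filter (_<? u) us ++ []) + (inv us + inv vs)
    ≡⟨ cong (λ ws → length ws + (inv us + inv vs)) (++-identityʳ (filter (_<? u) us)) ⟩
  length (filter (_<? u) us) + (inv us + inv vs)
    ≡⟨ +-assoc _ (inv us) (inv vs) ⟨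
  length (filter (_<? u) us) + inv us + inv vs ∎
  where open ≡-Reasoning

inv-∷ʳ : ∀ xs x → inv (xs ++ [ x ]) ≡ length (filter (x <?_) xs) + inv xs
inv-∷ʳ [] x = refl
inv-∷ʳ (y ∷ xs) x = begin
  length (filter (_<? y) (xs ++ [ x ])) + inv (xs ++ [ x ])
    ≡⟨ cong₂ _+_ (trans (cong length (filter-++ (_<? y) xs [ x ])) (length-++ (filter (_<? y) xs))) (inv-∷ʳ xs x) ⟩
  (length (filter (_<? y) xs) + length (filter (_<? y) [ x ])) + (length (filter (x <?_) xs) + inv xs)
    ≡⟨ cong (_+ (length (filter (x <?_) xs) + inv xs))
         (trans (+-comm (length (filter (_<? y) xs)) _) (cong (_+ length (filter (_<? y) xs)) flip-singleton)) ⟩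
  (length (filter (x <?_) [ y ]) + length (filter (_<? y) xs)) + (length (filter (x <?_) xs) + inv xs)
    ≡⟨ interchange (length (filter (x <?_) [ y ])) (length (filter (_<? y) xs)) _ _ ⟩
  (length (filter (x <?_) [ y ]) + length (filter (x <?_) xs)) + (length (filter (_<? y) xs) + inv xs)
    ≡⟨ cong (_+ _) (trans (sym (length-++ (filter (x <?_) [ y ]))) (cong length (sym (filter-++ (x <?_) [ y ] xs)))) ⟩
  length (filter (x <?_) (y ∷ xs)) + (length (filter (_<? y) xs) + inv xs) ∎
  where
  open ≡-Reasoning
  flip-singleton : length (filter (_<? y) [ x ]) ≡ length (filter (x <?_) [ y ])
  -- Both filters decide the same comparison, which computes through this Boolean.
  flip-singleton with x <ᵇ y
  ... | true  = refl
  ... | false = refl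

inv-reverse : ∀ xs → inv (reverse xs) ≡ asc xs
inv-reverse [] = refl
inv-reverse (x ∷ xs) = trans (cong inv (unfold-reverse x xs)) (trans (inv-∷ʳ (reverse xs) x)
  (cong₂ _+_ (↭.↭-length (↭.filter-↭ (x <?_) (↭.↭-reverse xs))) (inv-reverse xs)))

inv-shift : ∀ s xs → inv (map (_+ s) xs) ≡ inv xs
inv-shift s [] = refl
inv-shift s (x ∷ xs) = cong₂ _+_
  (length-filter-map (_<? x) (_<? (x + s)) (_+ s) xs (λ _ → mk⇔ (+-monoˡ-< s) (+-cancelʳ-< s _ _)))
  (inv-shift s xs)

complement : ℕ → ℕ → ℕ
complement s x = s ∸ suc x

complement-cancel-< : ∀ s {x y} → complement s x < complement s y → y < x
complement-cancel-< s lt = s≤s⁻¹ (∸-cancelʳ-< {o = s} lt)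

complement-involutive : ∀ {x} → x < s → complement s (complement s x) ≡ x
complement-involutive {suc s} (s≤s x≤s) = m∸[m∸n]≡n x≤s

map-complement-involutive : (∀ {x} → x ∈ ws → x < s) → map (complement s) (map (complement s) ws) ≡ ws
map-complement-involutive {ws} bounded =
  trans (sym (map-∘ ws)) (map-id-local (All.tabulate (complement-involutive ∘ bounded)))

complement-downFrom : ∀ s → map (complement s) (downFrom s) ↭ downFrom s
complement-downFrom s = ↭-trans (↭-reflexive eq) (↭.↭-reverse (downFrom s))
  where
  applyUpTo-complement : ∀ s → applyUpTo (complement s) s ≡ downFrom s
  applyUpTo-complement zero    = refl
  applyUpTo-complement (suc s) = cong (s ∷_) (applyUpTo-complement s)
  eq : map (complement s) (downFrom s) ≡ reverse (downFrom s)
  eq = trans (map-downFrom (complement s) s)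
         (trans (sym (reverse-applyUpTo (complement s) s)) (cong reverse (applyUpTo-complement s)))

inv-complement : ∀ xs → (∀ {x} → x ∈ xs → x < s) → inv (map (complement s) xs) ≡ asc xs
inv-complement [] _ = refl
inv-complement {s} (x ∷ xs) bounded = cong₂ _+_
  (length-filter-map (x <?_) (_<? complement s x) (complement s) xs
    (λ y∈ → mk⇔ (λ x<y → ∸-monoʳ-< (s≤s x<y) (bounded (there y∈))) (complement-cancel-< s)))
  (inv-complement xs (bounded ∘ there))

-- Pattern avoidance under these maps and in direct sums

avoid₃-map : ∀ R S h → (∀ {x y z} → R (h x) (h y) (h z) → S x y z) → Avoid₃ S ws → Avoid₃ R (map h ws)
avoid₃-map _ _ h R⇒S avoid τ r with (_ ∷ _ ∷ _ ∷ []) , refl , σ ← ⊆-map⁻ h _ τ = avoid σ (R⇒S r)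

avoid₄-map : ∀ R S h → (∀ {w x y z} → R (h w) (h x) (h y) (h z) → S w x y z) → Avoid₄ S ws → Avoid₄ R (map h ws)
avoid₄-map _ _ h R⇒S avoid τ r with (_ ∷ _ ∷ _ ∷ _ ∷ []) , refl , σ ← ⊆-map⁻ h _ τ = avoid σ (R⇒S r)

⊆-reverse⁻ : {xs ys : List A} → xs ⊆ reverse ys → reverse xs ⊆ ys
⊆-reverse⁻ {xs = xs} {ys} τ = subst (reverse xs ⊆_) (reverse-involutive ys) (⊆.reverse⁺ τ)

avoid₃-reverse : ∀ R S → (∀ {x y z} → R x y z → S z y x) → Avoid₃ S ws → Avoid₃ R (reverse ws)
avoid₃-reverse _ _ R⇒S avoid τ r = avoid (⊆-reverse⁻ τ) (R⇒S r)

avoid₄-reverse : ∀ R S → (∀ {w x y z} → R w x y z → S z y x w) → Avoid₄ S ws → Avoid₄ R (reverse ws)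
avoid₄-reverse _ _ R⇒S avoid τ r = avoid (⊆-reverse⁻ τ) (R⇒S r)

-- With at most one letter in the low block, 324 is a 213 in the high one; with at least three, 132
-- lies in the low one; an even split would put the 3 below the 2.
sum-1324 : ∀ us → us ≪ vs → Avoid₃ 132-order us → Avoid₃ 213-order vs → Avoid₄ 1324-order (us ++ vs)
sum-1324 us us≪vs avoid-us avoid-vs τ (w<y , y<x , x<z) with ⊆-++⁻ us τ
... | [] , _ , refl , _ , ρ = avoid-vs (⊆-trans (_ ∷ʳ ⊆-refl) ρ) (y<x , x<z)
... | _ ∷ [] , _ , refl , _ , ρ = avoid-vs ρ (y<x , x<z)
... | _ ∷ _ ∷ [] , _ , refl , σ , ρ =
  <-asym y<x (us≪vs (to∈ (⊆-trans (_ ∷ʳ ⊆-refl) σ)) (to∈ (⊆-trans (refl ∷ minimum _) ρ)))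
... | _ ∷ _ ∷ _ ∷ [] , _ , refl , σ , _ = avoid-us σ (w<y , y<x)
... | _ ∷ _ ∷ _ ∷ _ ∷ [] , _ , refl , σ , _ = avoid-us (⊆-trans (refl ∷ refl ∷ refl ∷ minimum _) σ) (w<y , y<x)
... | _ ∷ _ ∷ _ ∷ _ ∷ _ ∷ _ , _ , () , _

-- Three or four letters in the low block include 243, a 132; one or two would put the 2 low and the
-- 1 high, against their order.
sum-2431 : ∀ us → us ≪ vs → Avoid₃ 132-order us → Avoid₄ 2431-order vs → Avoid₄ 2431-order (us ++ vs)
sum-2431 us us≪vs avoid-us avoid-vs τ (z<w , w<y , y<x) with ⊆-++⁻ us τ
... | [] , _ , refl , _ , ρ = avoid-vs ρ (z<w , w<y , y<x)
... | _ ∷ [] , _ , refl , σ , ρ = <-asym z<w (us≪vs (to∈ σ) (to∈ (⊆-trans (_ ∷ʳ _ ∷ʳ ⊆-refl) ρ)))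
... | _ ∷ _ ∷ [] , _ , refl , σ , ρ =
  <-asym z<w (us≪vs (to∈ (⊆-trans (refl ∷ minimum _) σ)) (to∈ (⊆-trans (_ ∷ʳ ⊆-refl) ρ)))
... | _ ∷ _ ∷ _ ∷ [] , _ , refl , σ , ρ = avoid-us σ (w<y , y<x)
... | _ ∷ _ ∷ _ ∷ _ ∷ [] , _ , refl , σ , _ = avoid-us (⊆-trans (refl ∷ refl ∷ refl ∷ minimum _) σ) (w<y , y<x)
... | _ ∷ _ ∷ _ ∷ _ ∷ _ ∷ _ , _ , () , _

-- The overall maximum must lie in a nonempty upper block; delete it and induct on the length of
-- that block.
blocks-↭ : ∀ t {us vs} → length vs ≡ t → us ≪ vs → us ++ vs ↭ downFrom (t + s) →
           us ↭ downFrom s × vs ↭ map (_+ s) (downFrom t)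
blocks-↭ zero {us} {[]} _ _ σ = subst (_↭ _) (++-identityʳ us) σ , ↭-refl
blocks-↭ {s} (suc t) {us} {vs} len us≪vs σ with ∈-++⁻ us (↭.∈-resp-↭ (↭-sym σ) (here refl))
... | inj₁ m∈us with _ , y∈ ← nonempty⇒∈ (subst (0 <_) (sym len) z<s) =
  contradiction (∈-downFrom⁻ (↭.∈-resp-↭ σ (∈-++⁺ʳ us y∈))) (≤⇒≯ (us≪vs m∈us y∈))
... | inj₂ m∈vs with bs , cs , refl ← ∈-∃++ m∈vs
  with us↭ , vs↭ ← blocks-↭ t {us} {bs ++ cs}
         (suc-injective (trans (sym (↭.↭-length (↭.shift (t + s) bs cs))) len))
         (λ x∈ y∈ → us≪vs x∈ (⊆.Any-resp-⊆ (⊆-insert bs) y∈))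
         (subst (_↭ _) (++-assoc us bs cs)
           (↭.drop-mid (us ++ bs) [] (subst (_↭ _) (sym (++-assoc us bs _)) σ)))
  = us↭ , ↭-trans (↭.shift (t + s) bs cs) (↭-prep _ vs↭)

-- Words encoded by pairs of codes

-- The direct sum of the two blocks: the low one is the complement of a 312-avoider, the high
-- one the reversal of a 312-avoider.
word : ℕ → List ℕ → List ℕ → List ℕ
word s fs gs = map (complement s) (build fs) ++ map (_+ s) (reverse (build gs))

module _ {s t : ℕ} {fs gs : List ℕ} (len-fs : length fs ≡ s) (len-gs : length gs ≡ t) where
  private
    low high : List ℕ
    low  = map (complement s) (build fs)
    high = map (_+ s) (reverse (build gs))

    low-↭ : low ↭ downFrom s
    low-↭ = ↭-trans (↭.map⁺ (complement s) (subst (λ n → build fs ↭ downFrom n) len-fs (build-↭ fs)))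
                    (complement-downFrom s)
    high-↭ : high ↭ map (_+ s) (downFrom t)
    high-↭ = ↭.map⁺ (_+ s) (↭-trans (↭.↭-reverse (build gs)) (subst (λ n → build gs ↭ downFrom n) len-gs (build-↭ gs)))

    downFrom-+ : ∀ t → map (_+ s) (downFrom t) ++ downFrom s ≡ downFrom (t + s)
    downFrom-+ zero    = refl
    downFrom-+ (suc t) = cong (t + s ∷_) (downFrom-+ t)

    low≪high : low ≪ high
    low≪high x∈ y∈ with _ , _ , refl ← ∈-map⁻ (_+ s) y∈ =
      ≤-trans (∈-downFrom⁻ (↭.∈-resp-↭ low-↭ x∈)) (m≤n+m s _)

    fs-bounded : ∀ {x} → x ∈ build fs → x < s
    fs-bounded = subst (_ <_) len-fs ∘ build-bounded fs

  word-↭ : word s fs gs ↭ downFrom (t + s)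
  word-↭ = ↭-trans (↭.++⁺ low-↭ high-↭) (↭-trans (↭.++-comm (downFrom s) _) (↭-reflexive (downFrom-+ t)))

  inv-word : Valid fs → Valid gs → inv (word s fs gs) ≡ sum fs + sum gs
  inv-word valid-fs valid-gs = begin
    inv (low ++ high)            ≡⟨ inv-++ low low≪high ⟩
    inv low + inv high           ≡⟨ cong₂ _+_ (inv-complement (build fs) fs-bounded)
                                      (trans (inv-shift s (reverse (build gs))) (inv-reverse (build gs))) ⟩
    asc (build fs) + asc (build gs) ≡⟨ cong₂ _+_ (asc-build valid-fs) (asc-build valid-gs) ⟩
    sum fs + sum gs              ∎
    where open ≡-Reasoning

  private
    low-avoids : Linked _≥_ fs → Avoid₃ 132-order low
    low-avoids l = avoid₃-map 132-order 312-order (complement s)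
      (λ (p , q) → complement-cancel-< s q , complement-cancel-< s p) (linked⇒312-avoiding fs l)

  word-avoids-1324 : Linked _≥_ fs → Linked _≥_ gs → Avoid₄ 1324-order (word s fs gs)
  word-avoids-1324 lf lg = sum-1324 low low≪high (low-avoids lf)
    (avoid₃-map 213-order 213-order (_+ s) (λ (p , q) → +-cancelʳ-< s _ _ p , +-cancelʳ-< s _ _ q)
      (avoid₃-reverse 213-order 312-order id (linked⇒312-avoiding gs lg)))

  word-avoids-2431 : Linked _≥_ fs → Valid gs → Linked _≥_ gs → LocallySteep gs → Avoid₄ 2431-order (word s fs gs)
  word-avoids-2431 lf vg lg ls = sum-2431 low low≪high (low-avoids lf)
    (avoid₄-map 2431-order 2431-order (_+ s)
      (λ (p , q , r) → +-cancelʳ-< s _ _ p , +-cancelʳ-< s _ _ q , +-cancelʳ-< s _ _ r)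
      (avoid₄-reverse 2431-order 1342-order id (steep⇒1342-avoiding vg lg ls)))

-- Cutting at position `s` recovers both blocks; complement, shift and reversal can then be undone.
word-injective : ∀ {fs fs′ gs gs′} → length fs ≡ s → length fs′ ≡ s → length gs ≡ length gs′ →
                 Valid fs → Valid fs′ → Valid gs → Valid gs′ →
                 word s fs gs ≡ word s fs′ gs′ → fs ≡ fs′ × gs ≡ gs′
word-injective {s} {fs} {fs′} {gs} {gs′} len len′ len-gs vf vf′ vg vg′ eq
  = build-injective vf vf′ (trans len (sym len′)) fs≡ , build-injective vg vg′ len-gs gs≡
  where
  length-low : ∀ fs → length fs ≡ s → length (map (complement s) (build fs)) ≡ s
  length-low fs len = trans (length-map _ (build fs)) (trans (length-build fs) len)
  low = map (complement s) (build fs)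
  low′ = map (complement s) (build fs′)
  split = splitAt-++ low {map (_+ s) (reverse (build gs))} (length-low fs len)
  split′ = splitAt-++ low′ {map (_+ s) (reverse (build gs′))} (length-low fs′ len′)
  low≡ : low ≡ low′
  low≡ = trans (sym (proj₁ split)) (trans (cong (take s) eq) (proj₁ split′))
  fs≡ : build fs ≡ build fs′
  fs≡ = trans (sym (map-complement-involutive (subst (_ <_) len ∘ build-bounded fs)))
          (trans (cong (map (complement s)) low≡) (map-complement-involutive (subst (_ <_) len′ ∘ build-bounded fs′)))
  gs≡ : build gs ≡ build gs′
  gs≡ = reverse-injective (map-injective (+-cancelʳ-≡ s _ _)
          (trans (sym (proj₂ split)) (trans (cong (drop s) eq) (proj₂ split′))))

-- Decomposing avoiders into two blocks

split₄ : ∀ {l m n} (xs : List A) → l ≤ m → m ≤ n → n ≤ length xs →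
         ∃₂ λ as bs → ∃₂ λ cs ds → xs ≡ as ++ bs ++ cs ++ ds ×
           length as ≡ l × length (as ++ bs) ≡ m × length (as ++ bs ++ cs) ≡ n
split₄ {l = l} {m} {n} xs l≤m m≤n n≤ =
  take l (take m X) , drop l (take m X) , drop m X , drop n xs
  , sym (trans (sym (trans (++-assoc (take l (take m X) ++ _) (drop m X) _) (++-assoc (take l (take m X)) _ _)))
      (trans (cong (_++ drop n xs) X≡) (take++drop≡id n xs)))
  , length-take-≤ l (take m X) (subst (l ≤_) (sym len-m) l≤m)
  , trans (cong length (take++drop≡id l (take m X))) len-m
  , trans (cong length (trans (sym (++-assoc (take l (take m X)) _ _)) X≡)) len-n
  where
  X = take n xs
  len-n : length X ≡ n
  len-n = length-take-≤ n xs n≤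
  len-m : length (take m X) ≡ m
  len-m = length-take-≤ m X (subst (m ≤_) (sym len-n) m≤n)
  X≡ : (take l (take m X) ++ drop l (take m X)) ++ drop m X ≡ X
  X≡ = trans (cong (_++ drop m X) (take++drop≡id l (take m X))) (take++drop≡id m X)

take≪drop : ∀ us {vs} → length us ≡ n → us ≪ vs → take n (us ++ vs) ≪ drop n (us ++ vs)
take≪drop us len = let t , d = splitAt-++ us len in subst₂ _≪_ (sym t) (sym d)

take≪drop⁻ : ∀ us {vs} → length us ≡ n → take n (us ++ vs) ≪ drop n (us ++ vs) → us ≪ vs
take≪drop⁻ us len = let t , d = splitAt-++ us len in subst₂ _≪_ t d

-- There is a cut in [1, s] and another in [s, 2s - 1]; by 1324-avoidance the entries in
-- between are increasing.
cut-at : Unique ws → Avoid₄ 1324-order ws → inv ws < s → s + s ≤ length ws → take s ws ≪ drop s ws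
cut-at {ws} {s} unique avoid inv< len
  with u , 1≤u , u≤ , u-cut ← cut unique 1
     | u′ , s≤u′ , u′≤ , u′-cut ← cut unique s
  -- The second cut lies strictly before the end, so a letter remains to serve as the 4 of a 1324.
  with u′<len ← <-≤-trans (≤-<-trans u′≤ (+-monoʳ-< s inv<)) len
  with as , ms₁ , ms₂ , cs , refl , len-as , len-s , len-u′ ← split₄ ws (≤-trans u≤ inv<) s≤u′ (<⇒≤ u′<len)
  = subst (λ ws → take s ws ≪ drop s ws) (++-assoc as ms₁ _)
      (take≪drop (as ++ ms₁) len-s
        (middle-cut as ms₁ ms₂ unique avoid (take≪drop⁻ as len-as u-cut) ≪cs
          (proj₂ (nonempty⇒∈ (subst (1 ≤_) (sym len-as) 1≤u)))
          (proj₂ (nonempty⇒∈ 0<cs))))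
  where
  assoc : (as ++ ms₁ ++ ms₂) ++ cs ≡ as ++ ms₁ ++ ms₂ ++ cs
  assoc = trans (++-assoc as _ cs) (cong (as ++_) (++-assoc ms₁ ms₂ cs))
  ≪cs : as ++ ms₁ ++ ms₂ ≪ cs
  ≪cs = take≪drop⁻ (as ++ ms₁ ++ ms₂) len-u′ (subst (λ ws → take u′ ws ≪ drop u′ ws) (sym assoc) u′-cut)
  0<cs : 0 < length cs
  0<cs = +-cancelˡ-< u′ 0 (length cs) (subst₂ _<_ (sym (+-identityʳ u′))
    (trans (cong length (sym assoc)) (trans (length-++ (as ++ ms₁ ++ ms₂)) (cong (_+ length cs) len-u′))) u′<len)

module _ {us vs : List ℕ} (us≪vs : us ≪ vs) (avoid : Avoid₄ 1324-order (us ++ vs)) where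
  -- Any letter of the high block would complete a 132 to a 1324.
  low-avoids-132 : ∀ {d} → d ∈ vs → Avoid₃ 132-order us
  low-avoids-132 d∈ τ (x<z , z<y) =
    avoid (⊆.++⁺ τ (from∈ d∈)) (x<z , z<y , us≪vs (to∈ (⊆-trans (_ ∷ʳ refl ∷ minimum _) τ)) d∈)

  -- Any letter of the low block would complete a 213 to a 1324.
  high-avoids-213 : ∀ {a} → a ∈ us → Avoid₃ 213-order vs
  high-avoids-213 a∈ τ (y<x , x<z) =
    avoid (⊆.++⁺ (from∈ a∈) τ) (us≪vs a∈ (to∈ (⊆-trans (_ ∷ʳ refl ∷ minimum _) τ)) , y<x , x<z)

∸-cancelˡ-< : ∀ s {x y} → x ∸ s < y ∸ s → x < y
∸-cancelˡ-< s lt = ≰⇒> λ y≤x → <⇒≱ lt (∸-monoˡ-≤ s y≤x)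

block-codes : ∀ {us vs} → us ↭ downFrom s → vs ↭ map (_+ s) (downFrom t) →
              ∃₂ λ fs gs → length fs ≡ s × length gs ≡ t × Valid fs × Valid gs ×
                build fs ≡ map (complement s) us × build gs ≡ reverse (map (_∸ s) vs) ×
                word s fs gs ≡ us ++ vs
block-codes {s} {t} {us} {vs} us↭ vs↭
  with fs , len-fs , valid-fs , fs≡ ← build-surjective s
         (↭-trans (↭.map⁺ (complement s) us↭) (complement-downFrom s))
     | gs , len-gs , valid-gs , gs≡ ← build-surjective t
         (↭-trans (↭.↭-reverse (map (_∸ s) vs)) (↭-trans (↭.map⁺ (_∸ s) vs↭)
           (↭-reflexive (trans (sym (map-∘ (downFrom t))) (map-id-local (All.tabulate λ {x} _ → m+n∸n≡m x s))))))
  = fs , gs , len-fs , len-gs , valid-fs , valid-gs , fs≡ , gs≡ , cong₂ _++_ low high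
  where
  low : map (complement s) (build fs) ≡ us
  low = trans (cong (map (complement s)) fs≡)
              (map-complement-involutive (∈-downFrom⁻ ∘ ↭.∈-resp-↭ us↭))
  s≤ : ∀ {y} → y ∈ vs → s ≤ y
  s≤ y∈ with _ , _ , refl ← ∈-map⁻ (_+ s) (↭.∈-resp-↭ vs↭ y∈) = m≤n+m s _
  high : map (_+ s) (reverse (build gs)) ≡ vs
  high = trans (cong (map (_+ s)) (trans (cong reverse gs≡) (reverse-involutive (map (_∸ s) vs))))
               (trans (sym (map-∘ vs)) (map-id-local (All.tabulate (m∸n+n≡m ∘ s≤))))

AvoiderCodes : ℕ → ℕ → List ℕ → List ℕ → Set
AvoiderCodes s t fs gs = length fs ≡ s × length gs ≡ t × Valid fs × Valid gs ×
  Linked _≥_ fs × Linked _≥_ gs × LocallySteep gs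

-- Complementing turns 132 in the low block into 312; reversing turns 213 and 2431 in the high block
-- into 312 and 1342. The code characterisations then apply to each block.
avoider-codes : ∀ {us vs a d} → a ∈ us → d ∈ vs → us ≪ vs → us ↭ downFrom s → vs ↭ map (_+ s) (downFrom t) →
                Avoid₄ 1324-order (us ++ vs) → Avoid₄ 2431-order (us ++ vs) →
                ∃₂ λ fs gs → AvoiderCodes s t fs gs × word s fs gs ≡ us ++ vs
avoider-codes {s} {us = us} a∈ d∈ us≪vs us↭ vs↭ 1324-avoid 2431-avoid
  with fs , gs , len-fs , len-gs , valid-fs , valid-gs , fs≡ , gs≡ , word≡ ← block-codes us↭ vs↭
  with linked-gs ← 312-avoiding⇒linked valid-gs (subst (Avoid₃ 312-order) (sym gs≡)
         (avoid₃-reverse 312-order 213-order id (avoid₃-map 213-order 213-order (_∸ s)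
           (λ (p , q) → ∸-cancelˡ-< s p , ∸-cancelˡ-< s q)
           (high-avoids-213 us≪vs 1324-avoid a∈))))
  = fs , gs , (len-fs , len-gs , valid-fs , valid-gs
  , 312-avoiding⇒linked valid-fs (subst (Avoid₃ 312-order) (sym fs≡)
      (avoid₃-map 312-order 132-order (complement s)
        (λ (p , q) → complement-cancel-< s q , complement-cancel-< s p)
        (low-avoids-132 us≪vs 1324-avoid d∈)))
  , linked-gs
  , 1342-avoiding⇒steep valid-gs linked-gs (subst (Avoid₄ 1342-order) (sym gs≡)
      (avoid₄-reverse 1342-order 2431-order id (avoid₄-map 2431-order 2431-order (_∸ s)
        (λ (p , q , r) → ∸-cancelˡ-< s p , ∸-cancelˡ-< s q , ∸-cancelˡ-< s r)
        (2431-avoid ∘ ⊆.++⁺ˡ us)))))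
  , word≡

-- Only the existence of the codes matters; unfolding them later on would be expensive.
abstract
  word-surjective : ∀ s t {ws} → s ≤ t → ws ↭ downFrom (t + s) → inv ws < s →
                    Avoid₄ 1324-order ws → Avoid₄ 2431-order ws →
                    ∃₂ λ fs gs → AvoiderCodes s t fs gs × word s fs gs ≡ ws
  word-surjective s t {ws} s≤t ws↭ inv< 1324-avoid 2431-avoid =
    let us↭ , vs↭ = blocks-↭ t len-vs us≪vs (subst (_↭ _) (sym ws≡) ws↭)
        fs , gs , codes , word≡ = avoider-codes
          (proj₂ (nonempty⇒∈ (subst (0 <_) (sym len-us) 0<s)))
          (proj₂ (nonempty⇒∈ (subst (0 <_) (sym len-vs) (≤-trans 0<s s≤t))))
          us≪vs us↭ vs↭
          (subst (Avoid₄ 1324-order) (sym ws≡) 1324-avoid) (subst (Avoid₄ 2431-order) (sym ws≡) 2431-avoid)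
    in fs , gs , codes , trans word≡ ws≡
    where
    0<s : 0 < s
    0<s = ≤-<-trans z≤n inv<
    ws≡ : take s ws ++ drop s ws ≡ ws
    ws≡ = take++drop≡id s ws
    len : length ws ≡ t + s
    len = trans (↭.↭-length ws↭) (length-downFrom _)
    len-us : length (take s ws) ≡ s
    len-us = length-take-≤ s ws (subst (s ≤_) (sym len) (m≤n+m s t))
    len-vs : length (drop s ws) ≡ t
    len-vs = trans (length-drop s ws) (trans (cong (_∸ s) len) (m+n∸n≡m t s))
    us≪vs : take s ws ≪ drop s ws
    us≪vs = cut-at (unique-↭ (↭-sym ws↭) (Unique.downFrom⁺ _)) 1324-avoid inv<
              (subst (s + s ≤_) (sym len) (+-monoˡ-≤ s s≤t))


-- Permutations as vectors and as lists of naturals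

∈-∷⁻ : ∀ {x y : A} {ys} → x ≢ y → y ∈ x ∷ ys → y ∈ ys
∈-∷⁻ x≢y (here refl) = contradiction refl x≢y
∈-∷⁻ _   (there y∈)  = y∈

⊆⇒↭ : {xs ys : List A} → Unique xs → (∀ {x} → x ∈ xs → x ∈ ys) → ∃ λ zs → ys ↭ xs ++ zs
⊆⇒↭ [] _ = _ , ↭-refl
⊆⇒↭ {xs = x ∷ xs} (x∉ ∷ unique) sub
  with as , bs , refl ← ∈-∃++ (sub (here refl))
  with zs , eq ← ⊆⇒↭ {ys = as ++ bs} unique
         (λ y∈ → ∈-∷⁻ (All.lookup x∉ y∈) (↭.∈-resp-↭ (↭.shift x as bs) (sub (there y∈))))
  = zs , ↭-trans (↭.shift x as bs) (↭-prep x eq)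

unique-⊆-↭ : {xs ys : List A} → Unique xs → (∀ {x} → x ∈ xs → x ∈ ys) → length xs ≡ length ys → xs ↭ ys
unique-⊆-↭ {xs = xs} {ys} unique sub len with ⊆⇒↭ unique sub
... | [] , eq = ↭-sym (subst (ys ↭_) (++-identityʳ xs) eq)
... | z ∷ zs , eq = contradiction
  (trans len (trans (↭.↭-length eq) (length-++ xs))) (<⇒≢ (m<m+n (length xs) z<s))

entries : Vec (Fin n) m → List ℕ
entries v = map toℕ (toList v)

toList-unique : {v : Vec A m} → Vec.Unique v → Unique (toList v)
toList-unique []       = []
toList-unique (x∉ ∷ u) = VecAll.toList⁺ x∉ ∷ toList-unique u

toList-unique⁻ : (v : Vec A m) → Unique (toList v) → Vec.Unique v
toList-unique⁻ []      _        = []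
toList-unique⁻ (_ ∷ v) (x∉ ∷ u) = VecAll.toList⁻ x∉ ∷ toList-unique⁻ v u

-- Pigeonhole: `n` distinct values below `n` exhaust `downFrom n`.
entries-↭ : (π : Vec (Fin n) n) → Vec.Unique π → entries π ↭ downFrom n
entries-↭ {n} π unique = unique-⊆-↭ (Unique.map⁺ Fin.toℕ-injective (toList-unique unique))
  (λ x∈ → let i , _ , eq = ∈-map⁻ toℕ x∈ in ∈-downFrom⁺ (subst (_< n) (sym eq) (Fin.toℕ<n i)))
  (trans (length-map toℕ (toList π)) (trans (Vec.length-toList π) (sym (length-downFrom n))))

entries-injective : {v v′ : Vec (Fin n) m} → entries v ≡ entries v′ → v ≡ v′
entries-injective {v = v} {v′} eq =
  trans (sym (Vec.cast-is-id refl v)) (Vec.toList-injective refl v v′ (map-injective Fin.toℕ-injective eq))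

toFins : ∀ ws → length ws ≡ m → (∀ {x} → x ∈ ws → x < n) → ∃ λ (v : Vec (Fin n) m) → entries v ≡ ws
toFins []       refl _ = [] , refl
toFins (w ∷ ws) refl bounded with v , eq ← toFins ws refl (bounded ∘ there) =
  fromℕ< (bounded (here refl)) ∷ v , cong₂ _∷_ (Fin.toℕ-fromℕ< _) eq

entries-surjective : ws ↭ downFrom n → ∃ λ (π : Vec (Fin n) n) → Vec.Unique π × entries π ≡ ws
entries-surjective {ws} {n} ws↭
  with π , refl ← toFins ws (trans (↭.↭-length ws↭) (length-downFrom n)) (∈-downFrom⁻ ∘ ↭.∈-resp-↭ ws↭)
  = π , toList-unique⁻ π (Unique.map⁻ (unique-↭ (↭-sym ws↭) (Unique.downFrom⁺ n))) , refl

-- Occurrences of patterns as sublists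

unsuc : (is : List (Fin (suc m))) → All (zero {m} Fin.<_) is → ∃ λ js → is ≡ map suc js
unsuc []           []       = [] , refl
unsuc (suc i ∷ is) (_ ∷ ps) with js , refl ← unsuc is ps = i ∷ js , refl

AllPairs-map-suc⁻ : {is : List (Fin m)} → AllPairs Fin._<_ (map suc is) → AllPairs Fin._<_ is
AllPairs-map-suc⁻ inc = AllPairs.map s≤s⁻¹ (AllPairs.map⁻ inc)

-- With `⊆-lookups`, this translates between the increasing positions of `Contains` and the sublists
-- of `Avoid₄`.
lookups-⊆ : (v : Vec A m) (is : List (Fin m)) → AllPairs Fin._<_ is → map (lookup v) is ⊆ toList v
lookups-⊆ []      []       _ = []
lookups-⊆ (x ∷ v) []       _ = minimum _
lookups-⊆ (x ∷ v) (zero ∷ is) (is> ∷ inc) with js , refl ← unsuc is is> =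
  refl ∷ subst (_⊆ toList v) (map-∘ js) (lookups-⊆ v js (AllPairs-map-suc⁻ inc))
-- Positions after a positive one are positive too, so all of them belong to the tail.
lookups-⊆ (x ∷ v) (suc i ∷ is) inc@(is> ∷ _) with js , refl ← unsuc is (All.map (≤-trans (z<s {suc (toℕ i)})) is>) =
  x ∷ʳ subst (_⊆ toList v) (map-∘ (i ∷ js)) (lookups-⊆ v (i ∷ js) (AllPairs-map-suc⁻ inc))

⊆-lookups : (v : Vec A m) {xs : List A} → xs ⊆ toList v →
            ∃ λ is → AllPairs Fin._<_ is × xs ≡ map (lookup v) is
⊆-lookups []      []       = [] , [] , refl
⊆-lookups (x ∷ v) (_ ∷ʳ τ) with is , inc , refl ← ⊆-lookups v τ =
  map suc is , AllPairs.map⁺ (AllPairs.map s≤s inc) , map-∘ is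
⊆-lookups (x ∷ v) (refl ∷ τ) with is , inc , refl ← ⊆-lookups v τ =
  zero ∷ map suc is , All.map⁺ (All.tabulate λ _ → z<s) ∷ AllPairs.map⁺ (AllPairs.map s≤s inc)
  , cong (x ∷_) (map-∘ is)

lookup-AllPairs : {R : Rel A 0ℓ} (xs : List A) → AllPairs R xs →
                  ∀ a b → a Fin.< b → R (lookup (fromList xs) a) (lookup (fromList xs) b)
lookup-AllPairs (x ∷ xs) (x∼ ∷ _) zero    (suc b) _         = All.lookup x∼ (∈-lookup-fromList xs b)
  where
  ∈-lookup-fromList : (xs : List A) → ∀ b → lookup (fromList xs) b ∈ xs
  ∈-lookup-fromList (x ∷ xs) zero    = here refl
  ∈-lookup-fromList (x ∷ xs) (suc b) = there (∈-lookup-fromList xs b)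
lookup-AllPairs (x ∷ xs) (_ ∷ ps) (suc a) (suc b) (s≤s a<b) = lookup-AllPairs xs ps a b a<b

-- rank places the letters of q, which are 1, …, length q, among the increasing list cs.
order-isomorphic : (q : Pattern) (val : Fin (length q) → ℕ) (cs : List ℕ) (rank : Fin (length q) → Fin (length cs)) →
  AllPairs _<_ cs → (∀ a → List.lookup q a ≡ suc (toℕ (rank a))) →
  (∀ a → val a ≡ lookup (fromList cs) (rank a)) →
  ∀ a b → (List.lookup q a < List.lookup q b) ⇔ (val a < val b)
order-isomorphic q val cs rank inc q≡ val≡ a b
  rewrite q≡ a | q≡ b | val≡ a | val≡ b = mk⇔ (λ { (s≤s lt) → lookup-AllPairs cs inc (rank a) (rank b) lt }) reflect
  where
  reflect : lookup (fromList cs) (rank a) < lookup (fromList cs) (rank b) → suc (toℕ (rank a)) < suc (toℕ (rank b))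
  reflect lt with Fin.<-cmp (rank a) (rank b)
  ... | tri< ra<rb _ _ = s≤s ra<rb
  ... | tri≈ _ ra≡rb _ = contradiction lt (<-irrefl (cong (lookup (fromList cs)) ra≡rb))
  ... | tri> _ _ rb<ra = contradiction lt (<-asym (lookup-AllPairs cs inc (rank b) (rank a) rb<ra))

occurrence-⊆ : ∀ (π : Vec (Fin n) n) {i j k l} →
               let e = i ∷ j ∷ k ∷ l ∷ [] in
               (∀ a b → a Fin.< b → lookup e a Fin.< lookup e b) →
               toℕ (lookup π i) ∷ toℕ (lookup π j) ∷ toℕ (lookup π k) ∷ toℕ (lookup π l) ∷ [] ⊆ entries π
occurrence-⊆ π {i} {j} {k} {l} inc = ⊆.map⁺ toℕ (lookups-⊆ π (i ∷ j ∷ k ∷ l ∷ [])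
  ( (inc 0F 1F z<s ∷ inc 0F 2F z<s ∷ inc 0F 3F z<s ∷ [])
  ∷ (inc 1F 2F (s<s z<s) ∷ inc 1F 3F (s<s z<s) ∷ [])
  ∷ (inc 2F 3F (s<s (s<s z<s)) ∷ []) ∷ [] ∷ []))

⊆-positions : ∀ (π : Vec (Fin n) n) {w x y z} → w ∷ x ∷ y ∷ z ∷ [] ⊆ entries π →
              ∃ λ (e : Vec (Fin n) 4) → (∀ a b → a Fin.< b → lookup e a Fin.< lookup e b) ×
                Vec.map (toℕ ∘ lookup π) e ≡ w ∷ x ∷ y ∷ z ∷ []
⊆-positions π τ
  with (_ ∷ _ ∷ _ ∷ _ ∷ []) , refl , σ ← ⊆-map⁻ toℕ (toList π) τ
  with (i ∷ j ∷ k ∷ l ∷ []) , inc , refl ← ⊆-lookups π σ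
  = i ∷ j ∷ k ∷ l ∷ [] , lookup-AllPairs (i ∷ j ∷ k ∷ l ∷ []) inc , refl

1324-pattern 2431-pattern : Pattern
1324-pattern = 1 ∷ 3 ∷ 2 ∷ 4 ∷ []
2431-pattern = 2 ∷ 4 ∷ 3 ∷ 1 ∷ []

avoids-1324 : (π : Vec (Fin n) n) → (¬ Contains π 1324-pattern) ⇔ Avoid₄ 1324-order (entries π)
avoids-1324 π = mk⇔ to from
  where
  to : ¬ Contains π 1324-pattern → Avoid₄ 1324-order (entries π)
  to avoid τ (w<y , y<x , x<z) with (i ∷ j ∷ k ∷ l ∷ []) , inc , refl ← ⊆-positions π τ =
    avoid (i ∷ j ∷ k ∷ l ∷ [] , inc , order-isomorphic 1324-pattern _
      -- The four letters sorted by value, followed by the place of each position in that order.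
      (toℕ (lookup π i) ∷ toℕ (lookup π k) ∷ toℕ (lookup π j) ∷ toℕ (lookup π l) ∷ [])
      (lookup (0F ∷ 2F ∷ 1F ∷ 3F ∷ []))
      (Linked.Linked⇒AllPairs <-trans (w<y ∷ y<x ∷ x<z ∷ [-]))
      (λ { 0F → refl ; 1F → refl ; 2F → refl ; 3F → refl })
      (λ { 0F → refl ; 1F → refl ; 2F → refl ; 3F → refl }))
  from : Avoid₄ 1324-order (entries π) → ¬ Contains π 1324-pattern
  from avoid (_ ∷ _ ∷ _ ∷ _ ∷ [] , inc , iso) = avoid (occurrence-⊆ π inc)
    ( Equivalence.to (iso 0F 2F) (s<s z<s)
    , Equivalence.to (iso 2F 1F) (s<s (s<s z<s))
    , Equivalence.to (iso 1F 3F) (s<s (s<s (s<s z<s))))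

avoids-2431 : (π : Vec (Fin n) n) → (¬ Contains π 2431-pattern) ⇔ Avoid₄ 2431-order (entries π)
avoids-2431 π = mk⇔ to from
  where
  to : ¬ Contains π 2431-pattern → Avoid₄ 2431-order (entries π)
  to avoid τ (z<w , w<y , y<x) with (i ∷ j ∷ k ∷ l ∷ []) , inc , refl ← ⊆-positions π τ =
    avoid (i ∷ j ∷ k ∷ l ∷ [] , inc , order-isomorphic 2431-pattern _
      (toℕ (lookup π l) ∷ toℕ (lookup π i) ∷ toℕ (lookup π k) ∷ toℕ (lookup π j) ∷ [])
      (lookup (1F ∷ 3F ∷ 2F ∷ 0F ∷ []))
      (Linked.Linked⇒AllPairs <-trans (z<w ∷ w<y ∷ y<x ∷ [-]))
      (λ { 0F → refl ; 1F → refl ; 2F → refl ; 3F → refl })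
      (λ { 0F → refl ; 1F → refl ; 2F → refl ; 3F → refl }))
  from : Avoid₄ 2431-order (entries π) → ¬ Contains π 2431-pattern
  from avoid (_ ∷ _ ∷ _ ∷ _ ∷ [] , inc , iso) = avoid (occurrence-⊆ π inc)
    ( Equivalence.to (iso 3F 0F) (s<s z<s)
    , Equivalence.to (iso 0F 2F) (s<s (s<s z<s))
    , Equivalence.to (iso 2F 1F) (s<s (s<s (s<s z<s))))

-- Agreement of the two inversion counts

length-filter-cartesianProduct :
  {P : Pred (A × B) 0ℓ} (P? : Decidable P) (xs : List A) (ys : List B) →
  length (filter P? (cartesianProduct xs ys)) ≡ sum (map (λ x → length (filter (λ y → P? (x , y)) ys)) xs)
length-filter-cartesianProduct P? []       ys = refl
length-filter-cartesianProduct P? (x ∷ xs) ys = begin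
  length (filter P? (map (x ,_) ys ++ cartesianProduct xs ys))
    ≡⟨ cong length (filter-++ P? (map (x ,_) ys) _) ⟩
  length (filter P? (map (x ,_) ys) ++ filter P? (cartesianProduct xs ys))
    ≡⟨ length-++ (filter P? (map (x ,_) ys)) ⟩
  length (filter P? (map (x ,_) ys)) + length (filter P? (cartesianProduct xs ys))
    ≡⟨ cong₂ _+_ (length-filter-map (λ y → P? (x , y)) P? (x ,_) ys (λ _ → mk⇔ id id))
                 (length-filter-cartesianProduct P? xs ys) ⟩
  length (filter (λ y → P? (x , y)) ys) + sum (map (λ x → length (filter (λ y → P? (x , y)) ys)) xs) ∎
  where open ≡-Reasoning

allFin-suc : ∀ n → allFin (suc n) ≡ zero ∷ map suc (allFin n)
allFin-suc n = cong (zero ∷_) (sym (map-tabulate id suc))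

entries-allFin : (v : Vec (Fin n) m) → entries v ≡ map (toℕ ∘ lookup v) (allFin m)
entries-allFin []      = refl
entries-allFin {m = suc m} (x ∷ v) = trans (cong (toℕ x ∷_) (trans (entries-allFin v) (map-∘ (allFin m))))
  (cong (map (toℕ ∘ lookup (x ∷ v))) (sym (allFin-suc m)))

-- The length `m` is kept apart from the bound `n` on the values, so that an induction can remove
-- the first letter.
inversionsFrom : Vec (Fin n) m → Fin m → ℕ
inversionsFrom {m = m} v i = length (filter (λ j → (i Fin.<? j) ×-dec (lookup v j Fin.<? lookup v i)) (allFin m))

sum-inversionsFrom : (v : Vec (Fin n) m) → sum (map (inversionsFrom v) (allFin m)) ≡ inv (entries v)
sum-inversionsFrom [] = refl
sum-inversionsFrom {m = suc m} (x ∷ v) = begin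
  sum (map (inversionsFrom (x ∷ v)) (allFin (suc m)))
    ≡⟨ cong (sum ∘ map (inversionsFrom (x ∷ v))) (allFin-suc m) ⟩
  inversionsFrom (x ∷ v) zero + sum (map (inversionsFrom (x ∷ v)) (map suc (allFin m)))
    ≡⟨ cong₂ _+_ first (cong sum (trans (sym (map-∘ (allFin m))) (map-cong rest (allFin m)))) ⟩
  length (filter (_<? toℕ x) (entries v)) + sum (map (inversionsFrom v) (allFin m))
    ≡⟨ cong (length (filter (_<? toℕ x) (entries v)) +_) (sum-inversionsFrom v) ⟩
  inv (entries (x ∷ v)) ∎
  where
  open ≡-Reasoning
  inverted? : ∀ i → Decidable (λ j → i Fin.< j × lookup (x ∷ v) j Fin.< lookup (x ∷ v) i)
  inverted? i j = (i Fin.<? j) ×-dec (lookup (x ∷ v) j Fin.<? lookup (x ∷ v) i)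

  drop-zero : ∀ i → inversionsFrom (x ∷ v) i ≡ length (filter (inverted? i) (map suc (allFin m)))
  drop-zero i = trans (cong (length ∘ filter (inverted? i)) (allFin-suc m))
                      (cong length (filter-reject (inverted? i) {zero} {map suc (allFin m)} (λ { (() , _) })))

  first : inversionsFrom (x ∷ v) zero ≡ length (filter (_<? toℕ x) (entries v))
  first = begin
    inversionsFrom (x ∷ v) zero
      ≡⟨ drop-zero zero ⟩
    length (filter (inverted? zero) (map suc (allFin m)))
      ≡⟨ length-filter-map (λ j → lookup v j Fin.<? x) (inverted? zero) suc (allFin m) (λ _ → mk⇔ (z<s ,_) proj₂) ⟩
    length (filter (λ j → lookup v j Fin.<? x) (allFin m))
      ≡⟨ length-filter-map (λ j → lookup v j Fin.<? x) (_<? toℕ x) (toℕ ∘ lookup v) (allFin m) (λ _ → mk⇔ id id) ⟨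
    length (filter (_<? toℕ x) (map (toℕ ∘ lookup v) (allFin m)))
      ≡⟨ cong (length ∘ filter (_<? toℕ x)) (entries-allFin v) ⟨
    length (filter (_<? toℕ x) (entries v)) ∎

  rest : ∀ i → inversionsFrom (x ∷ v) (suc i) ≡ inversionsFrom v i
  rest i = trans (drop-zero (suc i))
    (length-filter-map (λ j → (i Fin.<? j) ×-dec (lookup v j Fin.<? lookup v i)) (inverted? (suc i)) suc (allFin m)
      (λ _ → mk⇔ (λ (p , q) → s<s p , q) (λ (p , q) → s<s⁻¹ p , q)))

inversions-inv : (π : Vec (Fin n) n) → inversions π ≡ inv (entries π)
inversions-inv {n} π = trans (length-filter-cartesianProduct (isInversion? π) (allFin n) (allFin n)) (sum-inversionsFrom π)


-- Partitions padded by zeros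

infixl 5 _0ⁿ_
_0ⁿ_ : List ℕ → ℕ → List ℕ
xs 0ⁿ m = xs ++ replicate m 0

valid-zeros : ∀ m → Valid (replicate m 0)
valid-zeros zero    = []
valid-zeros (suc m) = z≤n ∷ valid-zeros m

-- The sum stays below the remaining length, because deleting a positive part lowers the sum by at
-- least 1; hence each part fits the word built so far.
valid-0ⁿ : ∀ m → All (0 <_) xs → sum xs < length xs + m → Valid (xs 0ⁿ m)
valid-0ⁿ m [] _ = valid-zeros m
valid-0ⁿ {x ∷ xs} m (0<x ∷ pos) (s≤s le) =
  subst (x ≤_) (sym (trans (length-++ xs) (cong (length xs +_) (length-replicate m)))) (m+n≤o⇒m≤o x le)
  ∷ valid-0ⁿ m pos (<-≤-trans (m<n+m (sum xs) 0<x) le)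

hd-0ⁿ : ∀ xs m → hd (xs 0ⁿ m) ≡ hd xs
hd-0ⁿ []      zero    = refl
hd-0ⁿ []      (suc m) = refl
hd-0ⁿ (_ ∷ _) m       = refl

linked-0ⁿ : ∀ m → Linked _≥_ xs → Linked _≥_ (xs 0ⁿ m)
linked-0ⁿ {[]} zero    _ = []
linked-0ⁿ {[]} (suc m) _ = linked-∷ (≤-reflexive (hd-0ⁿ [] m)) (linked-0ⁿ m [])
linked-0ⁿ {x ∷ xs} m l = linked-∷ (subst (_≤ x) (sym (hd-0ⁿ xs m)) (hd-≤ l)) (linked-0ⁿ m (Linked.tail l))

sum-0ⁿ : ∀ xs m → sum (xs 0ⁿ m) ≡ sum xs
sum-0ⁿ xs m = trans (sum-++ xs (replicate m 0)) (trans (cong (sum xs +_) (sum-zeros m)) (+-identityʳ _))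
  where
  sum-zeros : ∀ m → sum (replicate m 0) ≡ 0
  sum-zeros zero    = refl
  sum-zeros (suc m) = sum-zeros m

multiplicity-0ⁿ : ∀ xs m → 0 < v → multiplicity v (xs 0ⁿ m) ≡ multiplicity v xs
multiplicity-0ⁿ {v} xs m 0<v = cong length (trans (filter-++ (v ≟_) xs (replicate m 0))
  (trans (cong (filter (v ≟_) xs ++_) (filter-none (v ≟_) (All.replicate⁺ m (>⇒≢ 0<v)))) (++-identityʳ _)))

length-0ⁿ : ∀ xs → length xs ≤ n → length (xs 0ⁿ (n ∸ length xs)) ≡ n
length-0ⁿ {n} xs le = trans (length-++ xs) (trans (cong (length xs +_) (length-replicate (n ∸ length xs))) (m+[n∸m]≡n le))

zeros : All (_≤ 0) xs → xs ≡ replicate (length xs) 0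
zeros []          = refl
zeros (z≤n ∷ le)  = cong (0 ∷_) (zeros le)

-- In a weakly decreasing list only zeros can follow the first zero.
linked⇒0ⁿ : Linked _≥_ fs → ∃₂ λ xs m → fs ≡ xs 0ⁿ m × All (0 <_) xs × Linked _≥_ xs
linked⇒0ⁿ {[]} _ = [] , 0 , refl , [] , []
linked⇒0ⁿ {zero ∷ fs} l = [] , _ , zeros (all-≤-hd l) , [] , []
linked⇒0ⁿ {suc f ∷ fs} l with xs , m , refl , pos , l′ ← linked⇒0ⁿ (Linked.tail l) =
  suc f ∷ xs , m , refl , z<s ∷ pos , linked-∷ (subst (_≤ suc f) (hd-0ⁿ xs m) (hd-≤ l)) l′

-- Filtering out the zeros recovers the partition.
0ⁿ-injective : ∀ {m n} → All (0 <_) xs → All (0 <_) ys → xs 0ⁿ m ≡ ys 0ⁿ n → xs ≡ ys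
0ⁿ-injective {xs} {ys} {m} {n} xs>0 ys>0 eq =
  trans (sym (positive m xs>0)) (trans (cong (filter (0 <?_)) eq) (positive n ys>0))
  where
  positive : ∀ {xs} m → All (0 <_) xs → filter (0 <?_) (xs 0ⁿ m) ≡ xs
  positive {xs} m pos = trans (filter-++ (0 <?_) xs (replicate m 0))
    (trans (cong₂ _++_ (filter-all (0 <?_) pos) (filter-none (0 <?_) (All.replicate⁺ m λ ()))) (++-identityʳ xs))

locallySteep-0ⁿ : ∀ m → LocallySteep xs → LocallySteep (xs 0ⁿ m)
locallySteep-0ⁿ zero [] = []
locallySteep-0ⁿ (suc m) [] = (λ 0<hd → contradiction (hd-0ⁿ [] m) (>⇒≢ 0<hd)) ∷ locallySteep-0ⁿ m []
locallySteep-0ⁿ {x ∷ xs} m (st ∷ ls) = head ∷ locallySteep-0ⁿ m ls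
  where
  head : 0 < hd (xs 0ⁿ m) → hd (xs 0ⁿ m) < x → multiplicity (hd (xs 0ⁿ m)) (xs 0ⁿ m) ≤ x ∸ hd (xs 0ⁿ m)
  head rewrite hd-0ⁿ xs m = λ 0<hd hd<x → subst (_≤ x ∸ hd xs) (sym (multiplicity-0ⁿ xs m 0<hd)) (st 0<hd hd<x)

locallySteep-0ⁿ⁻ : ∀ xs m → LocallySteep (xs 0ⁿ m) → LocallySteep xs
locallySteep-0ⁿ⁻ []       m _         = []
locallySteep-0ⁿ⁻ (x ∷ xs) m (st ∷ ls) = head st ∷ locallySteep-0ⁿ⁻ xs m ls
  where
  head : (0 < hd (xs 0ⁿ m) → hd (xs 0ⁿ m) < x → multiplicity (hd (xs 0ⁿ m)) (xs 0ⁿ m) ≤ x ∸ hd (xs 0ⁿ m)) →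
         0 < hd xs → hd xs < x → multiplicity (hd xs) xs ≤ x ∸ hd xs
  head st 0<hd hd<x with st′ ← st rewrite hd-0ⁿ xs m =
    subst (_≤ x ∸ hd xs) (multiplicity-0ⁿ xs m 0<hd) (st′ 0<hd hd<x)

-- Local and global steepness

multiplicity-≢ : ∀ {x v} xs → v ≢ x → multiplicity v (x ∷ xs) ≡ multiplicity v xs
multiplicity-≢ {v = v} xs v≢x = cong length (filter-reject (v ≟_) v≢x)

multiplicity-≤-∷ : ∀ x v xs → multiplicity v xs ≤ multiplicity v (x ∷ xs)
multiplicity-≤-∷ x v xs with v ≟ x
... | yes refl = ≤-trans (n≤1+n _) (≤-reflexive (sym (multiplicity-∷ v xs)))
... | no v≢x   = ≤-reflexive (sym (multiplicity-≢ xs v≢x))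

∈⇒≤-hd : Linked _≥_ xs → ∀ {z} → z ∈ xs → z ≤ hd xs
∈⇒≤-hd l = All.lookup (all-≤-hd l)

-- Steepness passes to the tail: restoring the largest entry puts nothing between two consecutive
-- parts and lowers no multiplicity.
steep⇒locallySteep : Linked _≥_ xs → Steep xs → LocallySteep xs
steep⇒locallySteep {[]} _ _ = []
steep⇒locallySteep {x ∷ []} _ _ = (λ ()) ∷ []
steep⇒locallySteep {x ∷ xs@(y ∷ ys)} l st = head ∷ steep⇒locallySteep (Linked.tail l) tail
  where
  head : 0 < y → y < x → multiplicity y xs ≤ x ∸ y
  head _ y<x = subst (_≤ x ∸ y) (multiplicity-≢ xs (<⇒≢ y<x))
    (st (there (here refl)) (here refl)
      (y<x , λ { (here refl) → inj₂ ≤-refl ; (there z∈) → inj₁ (∈⇒≤-hd (Linked.tail l) z∈) }))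
  tail : Steep xs
  tail {b} b∈ {a} a∈ (b<a , cons) = ≤-trans (multiplicity-≤-∷ x b xs)
    (st (there b∈) (there a∈) (b<a , λ { (here refl) → inj₂ (∈⇒≤-hd l (there a∈)) ; (there z∈) → cons z∈ }))

-- The new case is that the larger part is the first entry. By consecutiveness the next entry is
-- then either the smaller part, so the local condition applies, or a copy of the first entry, so
-- the tail decides.
locallySteep⇒steep : All (0 <_) xs → Linked _≥_ xs → LocallySteep xs → Steep xs
locallySteep⇒steep {x ∷ xs} (_ ∷ pos) l (st ∷ ls) {b} b∈ {a} a∈ (b<a , cons) with b∈
... | here refl = contradiction (∈⇒≤-hd l a∈) (<⇒≱ b<a)
... | there b∈xs = subst (_≤ a ∸ b) (sym (multiplicity-≢ xs (<⇒≢ b<x))) (main a∈)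
  where
  b<x : b < x
  b<x = <-≤-trans b<a (∈⇒≤-hd l a∈)
  steep-xs : Steep xs
  steep-xs = locallySteep⇒steep pos (Linked.tail l) ls
  hd∈ : ∀ {z zs} → z ∈ zs → hd zs ∈ zs
  hd∈ (here refl) = here refl
  hd∈ (there _)   = here refl
  main : a ∈ x ∷ xs → multiplicity b xs ≤ a ∸ b
  main (there a∈xs) = steep-xs b∈xs a∈xs (b<a , cons ∘ there)
  main (here refl) with cons (there (hd∈ b∈xs))
  ... | inj₁ hd≤b with refl ← ≤-antisym hd≤b (∈⇒≤-hd (Linked.tail l) b∈xs) = st (All.lookup pos b∈xs) b<a
  ... | inj₂ x≤hd with hd≡x ← ≤-antisym (hd-≤ l) x≤hd =
    steep-xs b∈xs (subst (_∈ xs) hd≡x (hd∈ b∈xs)) (b<a , cons ∘ there)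

-- Counting, and lists without repetition

-- Counting along a relation avoids choosing total functions between the two lists.
length-≤ : (R : A → B → Set) {xs : List A} {ys : List B} → Unique xs →
           (∀ {x} → x ∈ xs → ∃ λ y → y ∈ ys × R x y) →
           (∀ {x x′ y} → R x y → R x′ y → x ≡ x′) → length xs ≤ length ys
length-≤ R [] _ _ = z≤n
length-≤ R {x ∷ xs} (x∉ ∷ unique) total inj
  with y , y∈ , r ← total (here refl)
  with as , bs , refl ← ∈-∃++ y∈
  = subst (suc (length xs) ≤_) (sym (↭.↭-length (↭.shift y as bs)))
      (s≤s (length-≤ R unique
        (λ x′∈ → let y′ , y′∈ , r′ = total (there x′∈) in
          y′ , ∈-∷⁻ (λ y≡y′ → All.lookup x∉ x′∈ (inj r (subst (R _) (sym y≡y′) r′)))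
                    (↭.∈-resp-↭ (↭.shift y as bs) y′∈) , r′)
        inj))

length-≡ : (R : A → B → Set) {xs : List A} {ys : List B} → Unique xs → Unique ys →
           (∀ {x} → x ∈ xs → ∃ λ y → y ∈ ys × R x y) →
           (∀ {y} → y ∈ ys → ∃ λ x → x ∈ xs × R x y) →
           (∀ {x x′ y} → R x y → R x′ y → x ≡ x′) →
           (∀ {x y y′} → R x y → R x y′ → y ≡ y′) → length xs ≡ length ys
length-≡ R unique unique′ total surj inj fun =
  ≤-antisym (length-≤ R unique total inj) (length-≤ (λ y x → R x y) unique′ surj fun)

unique-concatMap : ∀ (f : A → List B) {xs} → Unique xs → (∀ x → Unique (f x)) →
                   (∀ {x x′ y} → y ∈ f x → y ∈ f x′ → x ≡ x′) → Unique (concatMap f xs)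
unique-concatMap f {xs} unique unique-f disjoint = Unique.concat⁺ (All.map⁺ (All.universal unique-f xs))
  (AllPairs.map⁺ (AllPairs.map (λ x≢x′ {_} (y∈ , y∈′) → x≢x′ (disjoint y∈ y∈′)) unique))

words-unique : ∀ {as : List A} → Unique as → ∀ m → Unique (words as m)
words-unique unique zero    = [] ∷ []
words-unique unique (suc m) = Unique.cartesianProductWith⁺ _∷_ Vec.∷-injective unique (words-unique unique m)

permutations-unique : ∀ n → Unique (permutations n)
permutations-unique n = Unique.filter⁺ _ (words-unique (Unique.allFin⁺ n) n)

partitions-unique : ∀ k → Unique (partitions k)
partitions-unique k = Unique.filter⁺ (isPartition? k)
  (unique-concatMap (λ l → map toList (words (upTo (suc k)) l)) (Unique.upTo⁺ (suc k))
    (λ l → Unique.map⁺ (λ {v} {v′} eq → trans (sym (Vec.cast-is-id refl v)) (Vec.toList-injective refl v v′ eq))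
                       (words-unique (Unique.upTo⁺ (suc k)) l))
    (λ xs∈ xs∈′ → trans (sym (length-word xs∈)) (length-word xs∈′)))
  where
  length-word : ∀ {l xs} → xs ∈ map toList (words (upTo (suc k)) l) → length xs ≡ l
  length-word xs∈ with v , _ , refl ← ∈-map⁻ toList xs∈ = Vec.length-toList v

∈-partitions⁻ : ∀ {k xs} → xs ∈ partitions k → IsPartition k xs
∈-partitions⁻ {k} xs∈ = proj₂ (∈-filter⁻ (isPartition? k)
  {xs = concatMap (λ l → map toList (words (upTo (suc k)) l)) (upTo (suc k))} xs∈)

-- Pairs of a partition and a steep partition

pairsAt : ℕ → ℕ → List (List ℕ × List ℕ)
pairsAt k i = cartesianProduct (partitions i) (filter steep? (partitions (k ∸ i)))

-- Grouped by the size of the first partition, to match the terms of the Cauchy product.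
partitionPairs : ℕ → List (List ℕ × List ℕ)
partitionPairs k = concatMap (pairsAt k) (upTo (suc k))

length-cartesianProduct : ∀ (xs : List A) (ys : List B) → length (cartesianProduct xs ys) ≡ length xs * length ys
length-cartesianProduct []       ys = refl
length-cartesianProduct (x ∷ xs) ys = trans (length-++ (map (x ,_) ys))
  (cong₂ _+_ (length-map (x ,_) ys) (length-cartesianProduct xs ys))

length-partitionPairs : ∀ k → length (partitionPairs k) ≡ (p · steep) k
length-partitionPairs k = go (upTo (suc k))
  where
  go : ∀ is → length (concatMap (pairsAt k) is) ≡ sum (map (λ i → p i * steep (k ∸ i)) is)
  go []       = refl
  go (i ∷ is) = trans (length-++ (pairsAt k i)) (cong₂ _+_ (length-cartesianProduct (partitions i) _) (go is))

record PartitionPair (k : ℕ) (xs ys : List ℕ) : Set where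
  constructor partitionPair
  field
    linked-xs   : Linked _≥_ xs
    positive-xs : All (0 <_) xs
    linked-ys   : Linked _≥_ ys
    positive-ys : All (0 <_) ys
    steep-ys    : Steep ys
    sum≡        : sum xs + sum ys ≡ k

∈-partitionPairs : PartitionPair k xs ys → (xs , ys) ∈ partitionPairs k
∈-partitionPairs {k} {xs} {ys} (partitionPair l pos l′ pos′ st sum≡) = ∈-concatMap⁺ (pairsAt k)
  (lose (∈-upTo⁺ (s≤s (subst (sum xs ≤_) sum≡ (m≤m+n (sum xs) (sum ys)))))
    (∈-cartesianProduct⁺ (∈-partitions (l , pos , refl)) (∈-filter⁺ steep? ys∈ st)))
  where
  ys∈ : ys ∈ partitions (k ∸ sum xs)
  ys∈ = ∈-partitions (l′ , pos′ , trans (sym (m+n∸m≡n (sum xs) (sum ys))) (cong (_∸ sum xs) sum≡))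

∈-pairsAt⁻ : ∀ k i → (xs , ys) ∈ pairsAt k i → IsPartition i xs × IsPartition (k ∸ i) ys × Steep ys
∈-pairsAt⁻ k i xy∈ with xs∈ , ys∈ ← ∈-cartesianProduct⁻ (partitions i) (filter steep? (partitions (k ∸ i))) xy∈
  with ys∈′ , st ← ∈-filter⁻ steep? {xs = partitions (k ∸ i)} ys∈
  = ∈-partitions⁻ xs∈ , ∈-partitions⁻ ys∈′ , st

∈-partitionPairs⁻ : (xs , ys) ∈ partitionPairs k → PartitionPair k xs ys
∈-partitionPairs⁻ {k = k} xy∈ with i , i∈ , xy∈′ ← find (∈-concatMap⁻ (pairsAt k) {xs = upTo (suc k)} xy∈)
  with (l , pos , refl) , (l′ , pos′ , eq) , st ← ∈-pairsAt⁻ k i xy∈′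
  = partitionPair l pos l′ pos′ st (trans (cong (i +_) eq) (m+[n∸m]≡n (s≤s⁻¹ (∈-upTo⁻ i∈))))

partitionPairs-unique : ∀ k → Unique (partitionPairs k)
partitionPairs-unique k = unique-concatMap (pairsAt k) (Unique.upTo⁺ (suc k))
  (λ i → Unique.cartesianProduct⁺ (partitions-unique i) (Unique.filter⁺ steep? (partitions-unique (k ∸ i))))
  (λ {i} {j} xy∈ xy∈′ →
    let (_ , _ , eq) , _ = ∈-pairsAt⁻ k i xy∈ ; (_ , _ , eq′) , _ = ∈-pairsAt⁻ k j xy∈′ in trans (sym eq) eq′)

-- The bijection between partition pairs and avoiders

Patterns : List Pattern
Patterns = 1324-pattern ∷ 2431-pattern ∷ []

length≤sum : All (0 <_) xs → length xs ≤ sum xs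
length≤sum []          = z≤n
length≤sum (0<x ∷ pos) = +-mono-≤ 0<x (length≤sum pos)

isAvoider? : ∀ k → Decidable (λ (π : Vec (Fin n) n) → inversions π ≡ k × Avoids Patterns π)
isAvoider? k π = (inversions π ≟ k) ×-dec avoids? Patterns π

avoiders : ∀ n → ℕ → List (Vec (Fin n) n)
avoiders n k = filter (isAvoider? k) (permutations n)

∈-avoiders⁺ : ∀ {π : Vec (Fin n) n} → Vec.Unique π → inversions π ≡ k → Avoids Patterns π → π ∈ avoiders n k
∈-avoiders⁺ {k = k} unique inv≡ avoid = ∈-filter⁺ (isAvoider? k) (∈-permutations unique) (inv≡ , avoid)

∈-avoiders⁻ : ∀ {π : Vec (Fin n) n} → π ∈ avoiders n k → Vec.Unique π × inversions π ≡ k × Avoids Patterns π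
∈-avoiders⁻ {n} {k} π∈ =
  let π∈′ , props = ∈-filter⁻ (isAvoider? k) {xs = permutations n} π∈
  in proj₂ (∈-filter⁻ (allPairs? (λ i j → ¬? (i Fin.≟ j))) {xs = words (allFin n) n} π∈′) , props

pad : ℕ → List ℕ → List ℕ
pad n xs = xs 0ⁿ (n ∸ length xs)

length-pad : All (0 <_) xs → sum xs < n → length (pad n xs) ≡ n
length-pad {xs} pos lt = length-0ⁿ xs (≤-trans (length≤sum pos) (<⇒≤ lt))

valid-pad : All (0 <_) xs → sum xs < n → Valid (pad n xs)
valid-pad {xs} {n} pos lt = valid-0ⁿ (n ∸ length xs) pos
  (subst (sum xs <_) (sym (m+[n∸m]≡n (≤-trans (length≤sum pos) (<⇒≤ lt)))) lt)

linked⇒pad : length fs ≡ n → Linked _≥_ fs → ∃ λ xs → fs ≡ pad n xs × All (0 <_) xs × Linked _≥_ xs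
linked⇒pad refl l with xs , m , refl , pos , l′ ← linked⇒0ⁿ l = xs , cong (xs 0ⁿ_) (sym (m≡ xs m)) , pos , l′
  where
  m≡ : ∀ xs m → length (xs 0ⁿ m) ∸ length xs ≡ m
  m≡ xs m = trans (cong (_∸ length xs) (trans (length-++ xs) (cong (length xs +_) (length-replicate m))))
                  (m+n∸m≡n (length xs) m)

-- `s` and `t` are the lengths of the low and high blocks. Both exceed `k`, so partitions of total
-- size `k` pad to valid codes, and `s ≤ t` leaves room for the cut at `s`.
module _ {k s t N : ℕ} (k<s : k < s) (s≤t : s ≤ t) (N≡ : N ≡ t + s) where
  sums< : PartitionPair k xs ys → sum xs < s × sum ys < t
  sums< {xs} {ys} (partitionPair _ _ _ _ _ sum≡) = ≤-<-trans (subst (sum xs ≤_) sum≡ (m≤m+n _ _)) k<s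
                                     , ≤-<-trans (subst (sum ys ≤_) sum≡ (m≤n+m _ (sum xs))) (<-≤-trans k<s s≤t)

  pairWord : List ℕ → List ℕ → List ℕ
  pairWord xs ys = word s (pad s xs) (pad t ys)

  module _ (pair : PartitionPair k xs ys) where
    open PartitionPair pair
    private
      len : length (pad s xs) ≡ s
      len = length-pad positive-xs (proj₁ (sums< pair))
      len′ : length (pad t ys) ≡ t
      len′ = length-pad positive-ys (proj₂ (sums< pair))
      valid : Valid (pad s xs)
      valid = valid-pad positive-xs (proj₁ (sums< pair))
      valid′ : Valid (pad t ys)
      valid′ = valid-pad positive-ys (proj₂ (sums< pair))
      linked : Linked _≥_ (pad s xs)
      linked = linked-0ⁿ _ linked-xs
      linked′ : Linked _≥_ (pad t ys)
      linked′ = linked-0ⁿ _ linked-ys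

    pairWord-↭ : pairWord xs ys ↭ downFrom N
    pairWord-↭ = subst (λ n → pairWord xs ys ↭ downFrom n) (sym N≡) (word-↭ {fs = pad s xs} {gs = pad t ys} len len′)

    inv-pairWord : inv (pairWord xs ys) ≡ k
    inv-pairWord = trans (inv-word len len′ valid valid′) (trans (cong₂ _+_ (sum-0ⁿ xs _) (sum-0ⁿ ys _)) sum≡)

    pairWord-avoids-1324 : Avoid₄ 1324-order (pairWord xs ys)
    pairWord-avoids-1324 = word-avoids-1324 len len′ linked linked′

    pairWord-avoids-2431 : Avoid₄ 2431-order (pairWord xs ys)
    pairWord-avoids-2431 = word-avoids-2431 len len′ linked valid′ linked′
      (locallySteep-0ⁿ _ (steep⇒locallySteep linked-ys steep-ys))

    pairWord-injective : PartitionPair k us vs → pairWord xs ys ≡ pairWord us vs → xs ≡ us × ys ≡ vs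
    pairWord-injective pair′@(partitionPair _ us>0 _ vs>0 _ _) eq =
      let lt , lt′ = sums< pair′
          fs≡ , gs≡ = word-injective len (length-pad us>0 lt) (trans len′ (sym (length-pad vs>0 lt′)))
                        valid (valid-pad us>0 lt) valid′ (valid-pad vs>0 lt′) eq
      in 0ⁿ-injective positive-xs us>0 fs≡ , 0ⁿ-injective positive-ys vs>0 gs≡

  codes⇒pair : AvoiderCodes s t fs gs → sum fs + sum gs ≡ k →
               ∃₂ λ xs ys → PartitionPair k xs ys × fs ≡ pad s xs × gs ≡ pad t ys
  codes⇒pair {fs} {gs} (len , len′ , valid , valid′ , linked , linked′ , ls) sum≡
    with xs , fs≡ , pos  , l  ← linked⇒pad {fs} len linked
       | ys , gs≡ , pos′ , l′ ← linked⇒pad {gs} len′ linked′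
    = xs , ys
    , partitionPair l pos l′ pos′
        (locallySteep⇒steep pos′ l′ (locallySteep-0ⁿ⁻ ys (t ∸ length ys) (subst LocallySteep gs≡ ls)))
        (trans (cong₂ _+_ (sum-padded xs fs≡) (sum-padded ys gs≡)) sum≡)
    , fs≡ , gs≡
    where
    sum-padded : ∀ xs → us ≡ pad n xs → sum xs ≡ sum us
    sum-padded {n = n} xs us≡ = trans (sym (sum-0ⁿ xs (n ∸ length xs))) (cong sum (sym us≡))

  codes⇒pairWord : ∀ {ws} → inv ws ≡ k → AvoiderCodes s t fs gs → word s fs gs ≡ ws →
                   ∃₂ λ xs ys → PartitionPair k xs ys × pairWord xs ys ≡ ws
  codes⇒pairWord {fs} {gs} inv≡ codes@(len , len′ , valid , valid′ , _) refl
    with xs , ys , pair , fs≡ , gs≡ ← codes⇒pair codes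
           (trans (sym (inv-word {fs = fs} {gs = gs} len len′ valid valid′)) inv≡)
    = xs , ys , pair , cong₂ (word s) (sym fs≡) (sym gs≡)

  pairWord-surjective : ∀ {ws} → ws ↭ downFrom N → inv ws ≡ k → Avoid₄ 1324-order ws → Avoid₄ 2431-order ws →
                        ∃₂ λ xs ys → PartitionPair k xs ys × pairWord xs ys ≡ ws
  pairWord-surjective ws↭ inv≡ 1324-avoid 2431-avoid
    with _ , _ , codes , eq ← word-surjective s t s≤t (subst (λ n → _ ↭ downFrom n) N≡ ws↭)
           (subst (_< s) (sym inv≡) k<s) 1324-avoid 2431-avoid
    = codes⇒pairWord inv≡ codes eq

  Encodes : List ℕ × List ℕ → Vec (Fin N) N → Set
  Encodes (xs , ys) π = PartitionPair k xs ys × entries π ≡ pairWord xs ys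

  encode : ∀ {xy} → xy ∈ partitionPairs k → ∃ λ π → π ∈ avoiders N k × Encodes xy π
  encode xy∈ =
    let pair = ∈-partitionPairs⁻ xy∈
        π , unique , eq = entries-surjective (pairWord-↭ pair)
    in π
     , ∈-avoiders⁺ unique (trans (inversions-inv π) (trans (cong inv eq) (inv-pairWord pair)))
         ( Equivalence.from (avoids-1324 π) (subst (Avoid₄ 1324-order) (sym eq) (pairWord-avoids-1324 pair))
         ∷ Equivalence.from (avoids-2431 π) (subst (Avoid₄ 2431-order) (sym eq) (pairWord-avoids-2431 pair))
         ∷ [])
     , pair , eq

  decode : ∀ {π} → π ∈ avoiders N k → ∃ λ xy → xy ∈ partitionPairs k × Encodes xy π
  decode {π} π∈
    with unique , inv≡ , avoid ← ∈-avoiders⁻ π∈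
    with xs , ys , pair , eq ← pairWord-surjective (entries-↭ π unique) (trans (sym (inversions-inv π)) inv≡)
          (Equivalence.to (avoids-1324 π) (All.head avoid))
          (Equivalence.to (avoids-2431 π) (All.head (All.tail avoid)))
    = (xs , ys) , ∈-partitionPairs pair , pair , sym eq

  encodes-injective : ∀ {xy xy′ π} → Encodes xy π → Encodes xy′ π → xy ≡ xy′
  encodes-injective (pair , eq) (pair′ , eq′) =
    let xs≡ , ys≡ = pairWord-injective pair pair′ (trans (sym eq) eq′) in cong₂ _,_ xs≡ ys≡

  length-avoiders : length (avoiders N k) ≡ (p · steep) k
  length-avoiders = trans (sym (length-≡ Encodes (partitionPairs-unique k)
                      (Unique.filter⁺ (isAvoider? k) (permutations-unique N))
                      encode decode encodes-injective
                      (λ (_ , eq) (_ , eq′) → entries-injective (trans eq (sym eq′)))))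
                    (length-partitionPairs k)

proposition5p13 : IsLimit ((1 ∷ 3 ∷ 2 ∷ 4 ∷ []) ∷ (2 ∷ 4 ∷ 3 ∷ 1 ∷ []) ∷ []) (p · steep)
-- The low block gets length `suc k`, the least above `k`; the threshold makes the rest at least as
-- long.
proposition5p13 k = suc k + suc k , λ n n≥ →
  length-avoiders {t = n ∸ suc k} ≤-refl (m+n≤o⇒m≤o∸n (suc k) n≥) (sym (m∸n+n≡m (m+n≤o⇒m≤o (suc k) n≥)))
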